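{- Let $\Sigma$ be a $(2,n)$-semitiling that is connected in codimension 1. Then $\Sigma$ extends to a complete tiling connected in codimension 1, i.e. there is a $(2,n)$-matroid tiling $\Sigma'\supseteq\Sigma$, connected in codimension 1, with $|\Sigma'|=\Delta(2,n)$.
   Context: $\Delta(2,n)=\mathrm{conv}\{1^A: A\subseteq[n],|A|=2\}\subset\mathbb{R}^n$, where $1^A$ is the indicator vector; it has dimension $n-1$. For a matroid $M$ on $[n]$, $\mathrm{BP}_M=\mathrm{conv}\{1^B:B\text{ a base}\}$. Two distinct polytopes are face-fitting if their intersection is empty or a common face. A $(2,n)$-semitiling is a finite collection $\Sigma$ of $(n-1)$-dimensional base polytopes of rank-2 matroids on $[n]$ such that for every codimension-2 cell $Q$ (a face of dimension $n-3$ of a member), the members having $Q$ as a face are pairwise face-fitting. A $(2,n)$-matroid tiling is such a collection whose members are pairwise face-fitting; $|\Sigma|$ is the union of the members. $\Sigma$ is connected in codimension 1 if any two members are joined by a sequence of members in which consecutive members intersect in a common facet.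
   Formalization: Points, polytopes, faces, dimensions and the union |Σ'| are taken in rational n-space instead of ℝ^n (all polytopes involved have 0/1 vertices), and n ≥ 3 is assumed, as the dimension n−1 of Δ(2,n) requires. -}

module Defs where

open import Data.Nat using (ℕ; zero; suc; _∸_)
open import Data.Fin using (Fin; zero; suc; _≟_)
open import Data.Bool using (Bool; true; false; if_then_else_; _∨_; not)
open import Data.Rational using (ℚ; 0ℚ; 1ℚ; _+_; _*_; _≤_)
open import Data.Product using (Σ; ∃; ∃₂; _×_; _,_)
open import Data.Sum using (_⊎_)
open import Data.List using (List)
open import Data.List.Membership.Propositional using (_∈_)
open import Relation.Nullary using (¬_; Dec)
open import Relation.Nullary.Decidable using (⌊_⌋)
open import Relation.Binary.PropositionalEquality using (_≡_; _≢_)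
open import Relation.Binary.Construct.Closure.ReflexiveTransitive using (Star)
open import Level using (0ℓ)

-- Points of ℚ^n (all polytopes here are rational)

Pt : ℕ → Set
Pt n = Fin n → ℚ

sumF : ∀ {m} → (Fin m → ℚ) → ℚ
sumF {zero}  f = 0ℚ
sumF {suc m} f = f zero + sumF (λ i → f (suc i))

_·_ : ∀ {n} → Pt n → Pt n → ℚ
c · x = sumF (λ k → c k * x k)

PSet : ℕ → Set₁
PSet n = Pt n → Set

ind : ∀ {n} → Fin n → Fin n → Pt n
ind i j k = if (⌊ k ≟ i ⌋ ∨ ⌊ k ≟ j ⌋) then 1ℚ else 0ℚ

Conv : ∀ {n} → (Fin n → Fin n → Bool) → PSet n
Conv {n} B x =
  Σ (Fin n → Fin n → ℚ) λ lam →
      (∀ i j → 0ℚ ≤ lam i j)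
    × (∀ i j → B i j ≡ false → lam i j ≡ 0ℚ)
    × (sumF (λ i → sumF (λ j → lam i j)) ≡ 1ℚ)
    × (∀ k → x k ≡ sumF (λ i → sumF (λ j → lam i j * ind i j k)))

Δ2 : (n : ℕ) → PSet n
Δ2 n = Conv {n} (λ i j → not ⌊ i ≟ j ⌋)

-- Rank-2 matroids on [n], given by their bases (2-element sets {i,j},
-- recorded symmetrically as base i j ≡ base j i ≡ true).

record Rank2Matroid (n : ℕ) : Set where
  field
    base     : Fin n → Fin n → Bool
    irrefl   : ∀ i → base i i ≡ false
    symm     : ∀ i j → base i j ≡ base j i
    nonempty : ∃₂ λ i j → base i j ≡ true
    exchange : ∀ a b c d → base a b ≡ true → base c d ≡ true →
               a ≢ c → a ≢ d →
               ∃ λ y → (y ≡ c ⊎ y ≡ d) × y ≢ a × y ≢ b × base b y ≡ true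

open Rank2Matroid public

BP : ∀ {n} → Rank2Matroid n → PSet n
BP M = Conv (base M)

_≐_ : ∀ {n} → PSet n → PSet n → Set
P ≐ Q = ∀ x → (P x → Q x) × (Q x → P x)

_∩_ : ∀ {n} → PSet n → PSet n → PSet n
(P ∩ Q) x = P x × Q x

IsFace : ∀ {n} → PSet n → PSet n → Set
IsFace {n} F P =
  Σ (Pt n) λ c → Σ ℚ λ b →
    (∀ x → P x → (c · x) ≤ b)
    × (∀ x → (F x → P x × (c · x) ≡ b) × (P x × (c · x) ≡ b → F x))

AffInd : ∀ {n m} → (Fin m → Pt n) → Set
AffInd {n} {m} v =
  ∀ (μ : Fin m → ℚ) → sumF μ ≡ 0ℚ →
    (∀ k → sumF (λ t → μ t * v t k) ≡ 0ℚ) → ∀ t → μ t ≡ 0ℚ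

HasDim : ∀ {n} → PSet n → ℕ → Set
HasDim {n} P d =
  (Σ (Fin (suc d) → Pt n) λ v → (∀ t → P (v t)) × AffInd v)
  × (∀ (v : Fin (suc (suc d)) → Pt n) → (∀ t → P (v t)) → ¬ AffInd v)

FaceFitting : ∀ {n} → PSet n → PSet n → Set
FaceFitting P Q =
  (∀ x → ¬ (P x × Q x)) ⊎ (IsFace (P ∩ Q) P × IsFace (P ∩ Q) Q)

-- Collections of rank-2 base polytopes (given by a list of matroids;
-- members are compared as polytopes, i.e. up to _≐_)

Collection : ℕ → Set
Collection n = List (Rank2Matroid n)

FullDim : ∀ {n} → Collection n → Set
FullDim {n} Σ' = ∀ M → M ∈ Σ' → HasDim (BP M) (n ∸ 1)

Semitiling : (n : ℕ) → Collection n → Set₁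
Semitiling n Σ' =
  FullDim Σ'
  × (∀ (Q : PSet n) →
       (Σ (Rank2Matroid n) λ M → M ∈ Σ' × IsFace Q (BP M) × HasDim Q (n ∸ 3)) →
       ∀ M₁ M₂ → M₁ ∈ Σ' → M₂ ∈ Σ' → IsFace Q (BP M₁) → IsFace Q (BP M₂) →
       ¬ (BP M₁ ≐ BP M₂) → FaceFitting (BP M₁) (BP M₂))

Tiling : (n : ℕ) → Collection n → Set
Tiling n Σ' =
  FullDim Σ'
  × (∀ M₁ M₂ → M₁ ∈ Σ' → M₂ ∈ Σ' → ¬ (BP M₁ ≐ BP M₂) →
       FaceFitting (BP M₁) (BP M₂))

FacetAdj : ∀ {n} → Collection n → Rank2Matroid n → Rank2Matroid n → Set
FacetAdj {n} Σ' M₁ M₂ =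
  M₁ ∈ Σ' × M₂ ∈ Σ'
  × IsFace (BP M₁ ∩ BP M₂) (BP M₁) × IsFace (BP M₁ ∩ BP M₂) (BP M₂)
  × HasDim (BP M₁ ∩ BP M₂) (n ∸ 2)

ConnectedCodim1 : ∀ {n} → Collection n → Set
ConnectedCodim1 Σ' =
  ∀ M₁ M₂ → M₁ ∈ Σ' → M₂ ∈ Σ' → Star (FacetAdj Σ') M₁ M₂

_⊑_ : ∀ {n} → Collection n → Collection n → Set
_⊑_ {n} Σ₁ Σ₂ =
  ∀ M → M ∈ Σ₁ → Σ (Rank2Matroid n) λ M' → M' ∈ Σ₂ × (BP M ≐ BP M')

Covers : ∀ {n} → Collection n → Set
Covers {n} Σ' =
  ∀ x → (Δ2 n x → Σ (Rank2Matroid n) λ M → M ∈ Σ' × BP M x)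
      × ((Σ (Rank2Matroid n) λ M → M ∈ Σ' × BP M x) → Δ2 n x)

{-# OPTIONS --safe #-}
module Submission where

-- A connected rank-2 matroid is a partition of [n] into at least three parallel classes, and its
-- polytope is cut out of Δ(2,n) by x(A) ≤ 1 for the classes A. Two members share a facet exactly when
-- a class of one is the complement of a class of the other. The semitiling condition at the cell
-- x(A) = 1, x_z = 0 makes the neighbour across a class unique, so the members form a tree: along a walk
-- without backtracking the sets left behind grow. Hence two distinct members have classes A, B with
-- A ∪ B = [n], which forces face-fitting. To complete the tree, attach across every non-singleton class
-- A without a neighbour the matroid with classes [n] ∖ A and the points of A. The result covers
-- Δ(2,n): from any member, cross a class with x(A) > 1; these classes shrink, so the walk ends at a
-- member containing x.

open import Defs
open import Data.Nat.Base as ℕ using (ℕ; zero; suc; s≤s; z≤n)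
import Data.Nat.Properties as ℕ
open import Data.Fin.Base using (Fin; zero; suc; punchIn; punchOut)
open import Data.Fin.Properties using (_≟_; any?; all?; suc-injective; punchIn-punchOut; punchOut-injective; punchIn-injective; punchInᵢ≢i)
open import Data.Fin.Subset using (∣_∣) renaming (_∈_ to _∈ˢ_)
open import Data.Fin.Subset.Properties using (p⊂q⇒∣p∣<∣q∣; ∣p∣≤n)
open import Data.Vec.Base using (tabulate)
open import Data.Vec.Properties using (lookup⇒[]=; []=⇒lookup; lookup∘tabulate)
open import Data.Vec.Functional using (insertAt)
open import Data.Vec.Functional.Properties using (insertAt-lookup; insertAt-punchIn)
open import Data.Bool.Base using (Bool; true; false; not; if_then_else_; _∧_; _xor_)
import Data.Bool.Properties as Bool
open import Data.Rational.Base using (ℚ; 0ℚ; 1ℚ; ½; _+_; _*_; _-_; -_; 1/_; _≤_; _<_; nonNegative; positive; ≢-nonZero)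
import Data.Rational.Properties as ℚ
open import Data.Rational.Solver using (module +-*-Solver)
open import Data.Product.Base using (Σ; ∃; ∃₂; _×_; _,_; proj₁; proj₂)
open import Data.Sum.Base as Sum using (_⊎_; inj₁; inj₂)
open import Data.Empty using (⊥; ⊥-elim)
open import Data.List.Base using (List; []; _∷_; _++_; allFin; cartesianProduct)
open import Data.List.Membership.Propositional using (_∈_; find; lose)
open import Data.List.Membership.Propositional.Properties using (∈-allFin; ∈-++⁺ˡ; ∈-++⁺ʳ; ∈-++⁻; ∈-cartesianProduct⁺; ∈-cartesianProduct⁻)
open import Data.List.Relation.Unary.Any as Any using (here; there)
open import Function.Base using (_∘_; case_of_; id)
open import Relation.Nullary using (¬_; Dec; yes; no)
open import Relation.Nullary.Decidable using (⌊_⌋; from-yes; from-no; ¬?; decidable-stable; _×-dec_; map′)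
open import Relation.Binary.Construct.Closure.ReflexiveTransitive as Star using (Star; ε; _◅_; _◅◅_)
open import Relation.Binary.PropositionalEquality
open ≡-Reasoning

-- Finite sums

-- The facet x(A) = 1 of a member with class A is the product of a simplex on A and one on its
-- complement, whatever the other classes are. Two members with a common class A thus share this
-- facet together with its codimension-2 faces, although the hypothesis never mentions facets; being
-- on the same side of it and face-fitting, they must coincide. This is how a condition on cells
-- controls the whole tree. Adding members must not destroy the covering pairs A ∪ B = [n]. For this
-- the tree argument also records that both covering classes have neighbours: a completion hangs on
-- a class without one, so the covering class lies in the complement of that class, which is a class
-- of the completion. That the inequalities x(A) ≤ 1 suffice is proved by moving weight between
-- pairs, clearing the interior of one class at a time.

sumF-cong : ∀ {m} {f g : Fin m → ℚ} → (∀ i → f i ≡ g i) → sumF f ≡ sumF g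
sumF-cong {zero}  e = refl
sumF-cong {suc m} e = cong₂ _+_ (e zero) (sumF-cong (e ∘ suc))

sumF-zero : ∀ {m} {f : Fin m → ℚ} → (∀ i → f i ≡ 0ℚ) → sumF f ≡ 0ℚ
sumF-zero {zero}  e = refl
sumF-zero {suc m} e = cong₂ _+_ (e zero) (sumF-zero (e ∘ suc))

+-interchange : ∀ a b c d → (a + b) + (c + d) ≡ (a + c) + (b + d)
+-interchange = solve 4 (λ a b c d → (a :+ b) :+ (c :+ d) := (a :+ c) :+ (b :+ d)) refl
  where open +-*-Solver

sumF-+ : ∀ {m} (f g : Fin m → ℚ) → sumF (λ i → f i + g i) ≡ sumF f + sumF g
sumF-+ {zero}  f g = refl
sumF-+ {suc m} f g =
  trans (cong (f zero + g zero +_) (sumF-+ (f ∘ suc) (g ∘ suc)))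
        (+-interchange (f zero) (g zero) (sumF (f ∘ suc)) (sumF (g ∘ suc)))

sumF-*ˡ : ∀ {m} c (f : Fin m → ℚ) → sumF (λ i → c * f i) ≡ c * sumF f
sumF-*ˡ {zero}  c f = sym (ℚ.*-zeroʳ c)
sumF-*ˡ {suc m} c f =
  trans (cong (c * f zero +_) (sumF-*ˡ c (f ∘ suc))) (sym (ℚ.*-distribˡ-+ c _ _))

sumF-*ʳ : ∀ {m} c (f : Fin m → ℚ) → sumF (λ i → f i * c) ≡ sumF f * c
sumF-*ʳ c f = trans (sumF-cong (λ i → ℚ.*-comm (f i) c)) (trans (sumF-*ˡ c f) (ℚ.*-comm c _))

sumF-swap : ∀ {m n} (f : Fin m → Fin n → ℚ) →
  sumF (λ i → sumF (f i)) ≡ sumF (λ j → sumF (λ i → f i j))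
sumF-swap {zero} {n} f = sym (sumF-zero {n} (λ _ → refl))
sumF-swap {suc m} f =
  trans (cong (sumF (f zero) +_) (sumF-swap (f ∘ suc))) (sym (sumF-+ (f zero) _))

+-nonneg : ∀ {p q} → 0ℚ ≤ p → 0ℚ ≤ q → 0ℚ ≤ p + q
+-nonneg = ℚ.+-mono-≤

*-nonneg : ∀ {p q} → 0ℚ ≤ p → 0ℚ ≤ q → 0ℚ ≤ p * q
*-nonneg {p} {q} 0≤p 0≤q =
  subst (_≤ p * q) (ℚ.*-zeroʳ p) (ℚ.*-monoˡ-≤-nonNeg p {{nonNegative 0≤p}} 0≤q)

sumF-nonneg : ∀ {m} {f : Fin m → ℚ} → (∀ i → 0ℚ ≤ f i) → 0ℚ ≤ sumF f
sumF-nonneg {zero}  h = ℚ.≤-refl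
sumF-nonneg {suc m} h = +-nonneg (h zero) (sumF-nonneg (h ∘ suc))

nonneg-+≡0 : ∀ {p q} → 0ℚ ≤ p → 0ℚ ≤ q → p + q ≡ 0ℚ → p ≡ 0ℚ × q ≡ 0ℚ
nonneg-+≡0 {p} {q} 0≤p 0≤q e =
  ℚ.≤-antisym (subst₂ _≤_ (ℚ.+-identityʳ p) e (ℚ.+-monoʳ-≤ p 0≤q)) 0≤p ,
  ℚ.≤-antisym (subst₂ _≤_ (ℚ.+-identityˡ q) e (ℚ.+-monoˡ-≤ q 0≤p)) 0≤q

sumF-nonneg≡0 : ∀ {m} {f : Fin m → ℚ} → (∀ i → 0ℚ ≤ f i) → sumF f ≡ 0ℚ → ∀ i → f i ≡ 0ℚ
sumF-nonneg≡0 {suc m} h e i with nonneg-+≡0 (h zero) (sumF-nonneg (h ∘ suc)) e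
sumF-nonneg≡0 {suc m} h e zero    | z , _ = z
sumF-nonneg≡0 {suc m} h e (suc i) | _ , r = sumF-nonneg≡0 (h ∘ suc) r i

sumF-punchIn : ∀ {m} (f : Fin (suc m) → ℚ) p → sumF f ≡ f p + sumF (f ∘ punchIn p)
sumF-punchIn f zero = refl
sumF-punchIn {suc m} f (suc p) = begin
  f zero + sumF (f ∘ suc)
    ≡⟨ cong (f zero +_) (sumF-punchIn (f ∘ suc) p) ⟩
  f zero + (f (suc p) + rest)
    ≡⟨ solve 3 (λ a b c → a :+ (b :+ c) := b :+ (a :+ c)) refl (f zero) (f (suc p)) rest ⟩
  f (suc p) + (f zero + rest) ∎
  where
  open +-*-Solver
  rest = sumF (f ∘ suc ∘ punchIn p)

sumF-single : ∀ {m} {f : Fin m → ℚ} t → (∀ s → s ≢ t → f s ≡ 0ℚ) → sumF f ≡ f t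
sumF-single {f = f} zero h =
  trans (cong (f zero +_) (sumF-zero (λ i → h (suc i) (λ ())))) (ℚ.+-identityʳ _)
sumF-single {f = f} (suc t) h =
  trans (cong₂ _+_ (h zero (λ ())) (sumF-single t (λ s s≢t → h (suc s) (s≢t ∘ suc-injective))))
        (ℚ.+-identityˡ _)

sumF-pair : ∀ {m} {f : Fin m → ℚ} p q → p ≢ q → (∀ s → s ≢ p → s ≢ q → f s ≡ 0ℚ) →
  sumF f ≡ f p + f q
sumF-pair zero zero p≢q h = ⊥-elim (p≢q refl)
sumF-pair {f = f} zero (suc q) p≢q h =
  cong (f zero +_) (sumF-single q (λ s s≢q → h (suc s) (λ ()) (s≢q ∘ suc-injective)))
sumF-pair {f = f} (suc p) zero p≢q h =
  trans (cong (f zero +_) (sumF-single p (λ s s≢p → h (suc s) (s≢p ∘ suc-injective) (λ ()))))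
        (ℚ.+-comm (f zero) _)
sumF-pair {f = f} (suc p) (suc q) p≢q h =
  trans (cong₂ _+_ (h zero (λ ()) (λ ()))
          (sumF-pair p q (p≢q ∘ cong suc)
            (λ s s≢p s≢q → h (suc s) (s≢p ∘ suc-injective) (s≢q ∘ suc-injective))))
        (ℚ.+-identityˡ _)

-- Edge weights

2ℚ : ℚ
2ℚ = 1ℚ + 1ℚ

χ : ∀ {n} → (Fin n → Bool) → Pt n
χ A k = if A k then 1ℚ else 0ℚ

χ-true : ∀ {n} (A : Fin n → Bool) {k} → A k ≡ true → χ A k ≡ 1ℚ
χ-true A e rewrite e = refl

χ-false : ∀ {n} (A : Fin n → Bool) {k} → A k ≡ false → χ A k ≡ 0ℚ
χ-false A e rewrite e = refl

δ : ∀ {n} → Fin n → Pt n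
δ i = χ (λ k → ⌊ k ≟ i ⌋)

δ-refl : ∀ {n} (i : Fin n) → δ i i ≡ 1ℚ
δ-refl i with i ≟ i
... | yes _ = refl
... | no ne = ⊥-elim (ne refl)

δ-≢ : ∀ {n} {i k : Fin n} → k ≢ i → δ i k ≡ 0ℚ
δ-≢ {i = i} {k} k≢i with k ≟ i
... | yes e = ⊥-elim (k≢i e)
... | no _  = refl

χ-nonneg : ∀ {n} (A : Fin n → Bool) k → 0ℚ ≤ χ A k
χ-nonneg A k with A k
... | true  = from-yes (0ℚ ℚ.≤? 1ℚ)
... | false = ℚ.≤-refl

sumF-δ : ∀ {n} (i : Fin n) (f : Fin n → ℚ) → sumF (λ k → δ i k * f k) ≡ f i
sumF-δ i f = trans
  (sumF-single i (λ s s≢i → trans (cong (_* f s) (δ-≢ s≢i)) (ℚ.*-zeroˡ (f s))))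
  (trans (cong (_* f i) (δ-refl i)) (ℚ.*-identityˡ (f i)))

δ-comm : ∀ {n} (i k : Fin n) → δ i k ≡ δ k i
δ-comm i k with k ≟ i | i ≟ k
... | yes _ | yes _ = refl
... | no _  | no _  = refl
... | yes e | no ne = ⊥-elim (ne (sym e))
... | no ne | yes e = ⊥-elim (ne (sym e))

ind-δ : ∀ {n} {i j : Fin n} → i ≢ j → ∀ k → ind i j k ≡ δ i k + δ j k
ind-δ {i = i} {j} i≢j k with k ≟ i | k ≟ j
... | yes e | yes f = ⊥-elim (i≢j (trans (sym e) f))
... | yes _ | no _  = refl
... | no _  | yes _ = refl
... | no _  | no _  = refl

ind-dot : ∀ {n} (c : Pt n) {i j} → i ≢ j → c · ind i j ≡ c i + c j
ind-dot c {i} {j} i≢j = begin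
  sumF (λ k → c k * ind i j k)
    ≡⟨ sumF-cong (λ k → trans (cong (c k *_) (ind-δ i≢j k)) (lem (c k) (δ i k) (δ j k))) ⟩
  sumF (λ k → δ i k * c k + δ j k * c k)
    ≡⟨ sumF-+ (λ k → δ i k * c k) _ ⟩
  sumF (λ k → δ i k * c k) + sumF (λ k → δ j k * c k)
    ≡⟨ cong₂ _+_ (sumF-δ i c) (sumF-δ j c) ⟩
  c i + c j ∎
  where
  open +-*-Solver
  lem : ∀ a b d → a * (b + d) ≡ b * a + d * a
  lem = solve 3 (λ a b d → a :* (b :+ d) := b :* a :+ d :* a) refl

vertex∈Conv : ∀ {n} (B : Fin n → Fin n → Bool) {i j} → B i j ≡ true → Conv B (ind i j)
vertex∈Conv B {i} {j} Bij =
  (λ a b → δ i a * δ j b) ,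
  (λ a b → *-nonneg (χ-nonneg (λ k → ⌊ k ≟ i ⌋) a) (χ-nonneg (λ k → ⌊ k ≟ j ⌋) b)) ,
  supp ,
  trans (sumF-cong (λ a → sumF-*ˡ (δ i a) (δ j)))
        (trans (sumF-δ i _) (trans (sumF-cong (λ b → sym (ℚ.*-identityʳ (δ j b)))) (sumF-δ j (λ _ → 1ℚ)))) ,
  λ k → sym (begin
    sumF (λ a → sumF (λ b → δ i a * δ j b * ind a b k))
      ≡⟨ sumF-cong (λ a → trans (sumF-cong (λ b → ℚ.*-assoc (δ i a) (δ j b) _)) (sumF-*ˡ (δ i a) (λ b → δ j b * ind a b k))) ⟩
    sumF (λ a → δ i a * sumF (λ b → δ j b * ind a b k))
      ≡⟨ sumF-δ i _ ⟩
    sumF (λ b → δ j b * ind i b k)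
      ≡⟨ sumF-δ j _ ⟩
    ind i j k ∎)
  where
  supp : ∀ a b → B a b ≡ false → δ i a * δ j b ≡ 0ℚ
  supp a b e with a ≟ i | b ≟ j
  ... | yes refl | yes refl = case trans (sym Bij) e of λ ()
  ... | yes _    | no _     = refl
  ... | no _     | yes _    = refl
  ... | no _     | no _     = refl

-- The zero diagonal matters: `ind i i` is the unit vector at `i`, not twice that vector, so a loop
-- would not be counted at both ends.
incidence-sum : ∀ {n} (lam : Fin n → Fin n → ℚ) → (∀ i → lam i i ≡ 0ℚ) → ∀ k →
  sumF (λ i → sumF (λ j → lam i j * ind i j k)) ≡ sumF (λ j → lam k j + lam j k)
incidence-sum lam diag k = begin
  sumF (λ i → sumF (λ j → lam i j * ind i j k))
    ≡⟨ sumF-cong (λ i → sumF-cong (split i)) ⟩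
  sumF (λ i → sumF (λ j → δ k i * lam i j + δ k j * lam i j))
    ≡⟨ sumF-cong (λ i → sumF-+ (λ j → δ k i * lam i j) (λ j → δ k j * lam i j)) ⟩
  sumF (λ i → sumF (λ j → δ k i * lam i j) + sumF (λ j → δ k j * lam i j))
    ≡⟨ sumF-+ (λ i → sumF (λ j → δ k i * lam i j)) _ ⟩
  sumF (λ i → sumF (λ j → δ k i * lam i j)) + sumF (λ i → sumF (λ j → δ k j * lam i j))
    ≡⟨ cong₂ _+_ (trans (sumF-cong (λ i → sumF-*ˡ (δ k i) (lam i))) (sumF-δ k _))
                 (sumF-cong (λ i → sumF-δ k (lam i))) ⟩
  sumF (lam k) + sumF (λ i → lam i k)
    ≡⟨ sumF-+ (lam k) (λ j → lam j k) ⟨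
  sumF (λ j → lam k j + lam j k) ∎
  where
  open +-*-Solver
  split : ∀ i j → lam i j * ind i j k ≡ δ k i * lam i j + δ k j * lam i j
  split i j with i ≟ j
  ... | yes refl rewrite diag i =
    solve 2 (λ a b → con 0ℚ :* a := b :* con 0ℚ :+ b :* con 0ℚ) refl (ind i i k) (δ k i)
  ... | no i≢j rewrite ind-δ i≢j k | δ-comm i k | δ-comm j k =
    solve 3 (λ a b c → c :* (a :+ b) := a :* c :+ b :* c) refl (δ k i) (δ k j) (lam i j)

-- A point of Conv B written as the degree vector of a symmetric edge weighting:
-- each edge is counted in both directions, hence the total 2.
record Weights {n} (B : Fin n → Fin n → Bool) (x : Pt n) : Set where
  constructor weights
  field
    w      : Fin n → Fin n → ℚ
    nonneg : ∀ a b → 0ℚ ≤ w a b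
    w-sym  : ∀ a b → w a b ≡ w b a
    supp   : ∀ a b → B a b ≡ false → w a b ≡ 0ℚ
    degree : ∀ k → x k ≡ sumF (w k)
    total  : sumF x ≡ 2ℚ

record Graph {n} (B : Fin n → Fin n → Bool) : Set where
  constructor graph
  field
    B-irrefl : ∀ i → B i i ≡ false
    B-sym    : ∀ i j → B i j ≡ B j i

edge-≢ : ∀ {n} {B : Fin n → Fin n → Bool} → Graph B → ∀ {i j} → B i j ≡ true → i ≢ j
edge-≢ G e refl = case trans (sym e) (Graph.B-irrefl G _) of λ ()

Conv⇒Weights : ∀ {n} {B : Fin n → Fin n → Bool} → Graph B → ∀ {x} → Conv B x → Weights B x
Conv⇒Weights {B = B} (graph irr sm) {x} (lam , nn , sp , one , pt) = weights
  (λ a b → lam a b + lam b a)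
  (λ a b → +-nonneg (nn a b) (nn b a))
  (λ a b → ℚ.+-comm (lam a b) (lam b a))
  (λ a b e → cong₂ _+_ (sp a b e) (sp b a (trans (sm b a) e)))
  deg
  (begin
    sumF x
      ≡⟨ sumF-cong deg ⟩
    sumF (λ a → sumF (λ b → lam a b + lam b a))
      ≡⟨ sumF-cong (λ a → sumF-+ (lam a) (λ b → lam b a)) ⟩
    sumF (λ a → sumF (lam a) + sumF (λ b → lam b a))
      ≡⟨ sumF-+ (λ a → sumF (lam a)) _ ⟩
    sumF (λ a → sumF (lam a)) + sumF (λ a → sumF (λ b → lam b a))
      ≡⟨ cong₂ _+_ one (trans (sumF-swap (λ a b → lam b a)) one) ⟩
    2ℚ ∎)
  where
  deg : ∀ k → x k ≡ sumF (λ b → lam k b + lam b k)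
  deg k = trans (pt k) (incidence-sum lam (λ i → sp i i (irr i)) k)

Weights⇒Conv : ∀ {n} {B : Fin n → Fin n → Bool} → Graph B → ∀ {x} → Weights B x → Conv B x
Weights⇒Conv {B = B} (graph irr sm) {x} (weights w nn w-sym sp deg tot) =
  (λ a b → ½ * w a b) ,
  (λ a b → *-nonneg (from-yes (0ℚ ℚ.≤? ½)) (nn a b)) ,
  half0 ,
  (begin
    sumF (λ a → sumF (λ b → ½ * w a b))
      ≡⟨ sumF-cong (λ a → trans (sumF-*ˡ ½ (w a)) (cong (½ *_) (sym (deg a)))) ⟩
    sumF (λ a → ½ * x a)
      ≡⟨ sumF-*ˡ ½ x ⟩
    ½ * sumF x
      ≡⟨ cong (½ *_) tot ⟩
    1ℚ ∎) ,
  λ k → sym (trans (incidence-sum (λ a b → ½ * w a b) (λ i → half0 i i (irr i)) k)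
        (trans (sumF-cong (λ b → trans (cong (λ z → ½ * w k b + ½ * z) (w-sym b k)) (halves (w k b))))
               (sym (deg k))))
  where
  open +-*-Solver
  half0 : ∀ a b → B a b ≡ false → ½ * w a b ≡ 0ℚ
  half0 a b e = cong (½ *_) (sp a b e)
  halves : ∀ a → ½ * a + ½ * a ≡ a
  halves = solve 1 (λ a → con ½ :* a :+ con ½ :* a := a) refl

p-q≡0⇒p≡q : ∀ {p q} → p - q ≡ 0ℚ → p ≡ q
p-q≡0⇒p≡q {p} {q} e = trans (solve 2 (λ p q → p := p :- q :+ q) refl p q)
  (trans (cong (_+ q) e) (ℚ.+-identityˡ q))
  where open +-*-Solver

0≤q-p⇒p≤q : ∀ {p q} → 0ℚ ≤ q - p → p ≤ q
0≤q-p⇒p≤q {p} {q} h = subst₂ _≤_ (ℚ.+-identityˡ p)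
  (solve 2 (λ p q → q :- p :+ p := q) refl p q) (ℚ.+-monoˡ-≤ p h)
  where open +-*-Solver

p≤q⇒0≤q-p : ∀ {p q} → p ≤ q → 0ℚ ≤ q - p
p≤q⇒0≤q-p {p} {q} h = subst (_≤ q - p) (ℚ.+-inverseʳ p) (ℚ.+-monoˡ-≤ (- p) h)

p+p≡0⇒p≡0 : ∀ {p} → p + p ≡ 0ℚ → p ≡ 0ℚ
p+p≡0⇒p≡0 {p} e = trans (solve 1 (λ p → p := con ½ :* (p :+ p)) refl p) (cong (½ *_) e)
  where open +-*-Solver

0≤p+p⇒0≤p : ∀ {p} → 0ℚ ≤ p + p → 0ℚ ≤ p
0≤p+p⇒0≤p {p} h = subst (0ℚ ≤_) (solve 1 (λ p → con ½ :* (p :+ p) := p) refl p)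
  (*-nonneg (from-yes (0ℚ ℚ.≤? ½)) h)
  where open +-*-Solver

*-zeroProduct : ∀ {p q} → p * q ≡ 0ℚ → p ≢ 0ℚ → q ≡ 0ℚ
*-zeroProduct {p} {q} e p≢0 = begin
  q                  ≡⟨ ℚ.*-identityˡ q ⟨
  1ℚ * q             ≡⟨ cong (_* q) (ℚ.*-inverseˡ p) ⟨
  1/ p * p * q       ≡⟨ ℚ.*-assoc (1/ p) p q ⟩
  1/ p * (p * q)     ≡⟨ cong (1/ p *_) e ⟩
  1/ p * 0ℚ          ≡⟨ ℚ.*-zeroʳ (1/ p) ⟩
  0ℚ ∎
  where instance _ = ≢-nonZero p≢0

module _ {n} {B : Fin n → Fin n → Bool} {x : Pt n} (W : Weights B x) (c : Pt n) where
  open Weights W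
  open +-*-Solver

  weights-dot : c · x ≡ sumF (λ a → sumF (λ b → c a * w a b))
  weights-dot = sumF-cong (λ a → trans (cong (c a *_) (degree a)) (sym (sumF-*ˡ (c a) (w a))))

  -- Symmetry of `w` makes the `c a` part and the `c b` part each sum to `c · x`, while `β`
  -- contributes `2β`. Twice the slack of the point is thus a sum of edge slacks: bounds checked on
  -- edges pass to `x`, and tightness at `x` passes back to the edges that carry weight.
  weights-slack : ∀ β → sumF (λ a → sumF (λ b → (β - (c a + c b)) * w a b)) ≡ (β - c · x) + (β - c · x)
  weights-slack β = begin
    sumF (λ a → sumF (λ b → (β - (c a + c b)) * w a b))
      ≡⟨ sumF-cong (λ a → sumF-cong (λ b → split (c a) (c b) (w a b))) ⟩
    sumF (λ a → sumF (λ b → (β * w a b + - 1ℚ * (c a * w a b)) + - 1ℚ * (c b * w a b)))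
      ≡⟨ sumF-cong (λ a → sumF-+ (λ b → β * w a b + - 1ℚ * (c a * w a b)) _) ⟩
    sumF (λ a → sumF (λ b → β * w a b + - 1ℚ * (c a * w a b)) + sumF (λ b → - 1ℚ * (c b * w a b)))
      ≡⟨ sumF-+ (λ a → sumF (λ b → β * w a b + - 1ℚ * (c a * w a b))) _ ⟩
    sumF (λ a → sumF (λ b → β * w a b + - 1ℚ * (c a * w a b))) + sumF (λ a → sumF (λ b → - 1ℚ * (c b * w a b)))
      ≡⟨ cong₂ _+_ (trans (sumF-cong (λ a → sumF-+ (λ b → β * w a b) _)) (sumF-+ (λ a → sumF (λ b → β * w a b)) _)) third ⟩
    (sumF (λ a → sumF (λ b → β * w a b)) + sumF (λ a → sumF (λ b → - 1ℚ * (c a * w a b)))) + - 1ℚ * (c · x)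
      ≡⟨ cong (λ z → z + - 1ℚ * (c · x)) (cong₂ _+_ first second) ⟩
    (β * 2ℚ + - 1ℚ * (c · x)) + - 1ℚ * (c · x)
      ≡⟨ solve 2 (λ β d → (β :* con 2ℚ :+ con (- 1ℚ) :* d) :+ con (- 1ℚ) :* d := (β :- d) :+ (β :- d)) refl β (c · x) ⟩
    (β - c · x) + (β - c · x) ∎
    where
    split : ∀ p q u → (β - (p + q)) * u ≡ (β * u + - 1ℚ * (p * u)) + - 1ℚ * (q * u)
    split = solve 4 (λ β p q u → (β :- (p :+ q)) :* u :=
              (β :* u :+ con (- 1ℚ) :* (p :* u)) :+ con (- 1ℚ) :* (q :* u)) refl β
    first : sumF (λ a → sumF (λ b → β * w a b)) ≡ β * 2ℚ
    first = trans (sumF-cong (λ a → trans (sumF-*ˡ β (w a)) (cong (β *_) (sym (degree a)))))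
              (trans (sumF-*ˡ β x) (cong (β *_) total))
    second : sumF (λ a → sumF (λ b → - 1ℚ * (c a * w a b))) ≡ - 1ℚ * (c · x)
    second = trans (sumF-cong (λ a → sumF-*ˡ (- 1ℚ) (λ b → c a * w a b)))
               (trans (sumF-*ˡ (- 1ℚ) (λ a → sumF (λ b → c a * w a b))) (cong (- 1ℚ *_) (sym weights-dot)))
    third : sumF (λ a → sumF (λ b → - 1ℚ * (c b * w a b))) ≡ - 1ℚ * (c · x)
    third = trans (sumF-swap (λ a b → - 1ℚ * (c b * w a b)))
      (trans (sumF-cong (λ a → sumF-cong (λ b → cong (λ z → - 1ℚ * (c a * z)) (w-sym b a)))) second)

  module _ {β} (valid : ∀ a b → B a b ≡ true → c a + c b ≤ β) where

    slack-nonneg : ∀ a b → 0ℚ ≤ (β - (c a + c b)) * w a b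
    slack-nonneg a b with B a b in e
    ... | true  = *-nonneg (p≤q⇒0≤q-p (valid a b e)) (nonneg a b)
    ... | false = ℚ.≤-reflexive (sym (trans (cong ((β - (c a + c b)) *_) (supp a b e)) (ℚ.*-zeroʳ (β - (c a + c b)))))

    valid-≤ : c · x ≤ β
    valid-≤ = 0≤q-p⇒p≤q (0≤p+p⇒0≤p (subst (0ℚ ≤_) (weights-slack β)
      (sumF-nonneg (λ a → sumF-nonneg (slack-nonneg a)))))

    -- An edge that is not tight for the valid inequality carries no weight.
    restrict : c · x ≡ β → ∀ {B'} → (∀ a b → B a b ≡ true → c a + c b ≡ β → B' a b ≡ true) →
      Weights B' x
    restrict tight {B'} h = weights w nonneg w-sym supp' degree total
      where
      slack≡0 : ∀ a b → (β - (c a + c b)) * w a b ≡ 0ℚ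
      slack≡0 a = sumF-nonneg≡0 (slack-nonneg a)
        (sumF-nonneg≡0 (λ a → sumF-nonneg (slack-nonneg a))
          (trans (weights-slack β) (cong (λ z → z + z) (trans (cong (λ z → β - z) tight) (ℚ.+-inverseʳ β)))) a)
      supp' : ∀ a b → B' a b ≡ false → w a b ≡ 0ℚ
      supp' a b e with B a b in eB
      ... | false = supp a b eB
      ... | true with c a + c b ℚ.≟ β
      ...   | yes t = case trans (sym (h a b eB t)) e of λ ()
      ...   | no nt = *-zeroProduct (slack≡0 a b) (λ z → nt (sym (p-q≡0⇒p≡q z)))

  valid-≡ : ∀ {β} → (∀ a b → B a b ≡ true → c a + c b ≡ β) → c · x ≡ β
  valid-≡ {β} h = sym (p-q≡0⇒p≡q (p+p≡0⇒p≡0 (trans (sym (weights-slack β))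
    (sumF-zero (λ a → sumF-zero (zero-term a))))))
    where
    zero-term : ∀ a b → (β - (c a + c b)) * w a b ≡ 0ℚ
    zero-term a b with B a b in e
    ... | true  = trans (cong (_* w a b) (trans (cong (λ z → β - z) (h a b e)) (ℚ.+-inverseʳ β))) (ℚ.*-zeroˡ (w a b))
    ... | false = trans (cong ((β - (c a + c b)) *_) (supp a b e)) (ℚ.*-zeroʳ (β - (c a + c b)))

-- Dimension

comb : ∀ {m n} → (Fin m → ℚ) → (Fin m → Pt n) → Pt n
comb μ v k = sumF (λ t → μ t * v t k)

𝟙 : ∀ {n} → Pt n
𝟙 _ = 1ℚ

comb-dot : ∀ {m n} (μ : Fin m → ℚ) (v : Fin m → Pt n) (c : Pt n) {β} →
  (∀ t → c · v t ≡ β) → c · comb μ v ≡ sumF μ * β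
comb-dot μ v c {β} h = begin
  sumF (λ k → c k * sumF (λ t → μ t * v t k))
    ≡⟨ sumF-cong (λ k → trans (sym (sumF-*ˡ (c k) (λ t → μ t * v t k)))
         (sumF-cong (λ t → rot (c k) (μ t) (v t k)))) ⟩
  sumF (λ k → sumF (λ t → μ t * (c k * v t k)))
    ≡⟨ sumF-swap (λ k t → μ t * (c k * v t k)) ⟩
  sumF (λ t → sumF (λ k → μ t * (c k * v t k)))
    ≡⟨ sumF-cong (λ t → trans (sumF-*ˡ (μ t) (λ k → c k * v t k)) (cong (μ t *_) (h t))) ⟩
  sumF (λ t → μ t * β)
    ≡⟨ sumF-*ʳ β μ ⟩
  sumF μ * β ∎
  where
  open +-*-Solver
  rot : ∀ a b d → a * (b * d) ≡ b * (a * d)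
  rot = solve 3 (λ a b d → a :* (b :* d) := b :* (a :* d)) refl

Dependent : ∀ {m n} → (Fin m → Pt n) → Set
Dependent {m} v = Σ (Fin m → ℚ) λ μ → (∃ λ t → μ t ≢ 0ℚ) × (∀ k → comb μ v k ≡ 0ℚ)

-- Fraction-free Gaussian elimination on the first coordinate.
dependent : ∀ m (v : Fin (suc m) → Pt m) → Dependent v
dependent zero v = (λ _ → 1ℚ) , (zero , λ ()) , λ ()
dependent (suc m) v with any? (λ t → ¬? (v t zero ℚ.≟ 0ℚ))
... | no none with dependent m (λ t k → v (suc t) (suc k))
...   | μ , (t , μt≢0) , h = μ⁺ , (suc t , μt≢0) , vanish
  where
  μ⁺ : Fin (suc (suc m)) → ℚ
  μ⁺ zero    = 0ℚ
  μ⁺ (suc t) = μ t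
  v0≡0 : ∀ t → v t zero ≡ 0ℚ
  v0≡0 t = decidable-stable (v t zero ℚ.≟ 0ℚ) (λ ne → none (t , ne))
  vanish : ∀ k → comb μ⁺ v k ≡ 0ℚ
  vanish zero    = sumF-zero (λ t → trans (cong (μ⁺ t *_) (v0≡0 t)) (ℚ.*-zeroʳ (μ⁺ t)))
  vanish (suc k) = cong₂ _+_ (ℚ.*-zeroˡ (v zero (suc k))) (h k)
dependent (suc m) v | yes (p , a≢0)
  with dependent m (λ t k → v p zero * v (punchIn p t) (suc k) - v (punchIn p t) zero * v p (suc k))
... | μ , (t , μt≢0) , h =
  ν , (punchIn p t , λ e → μt≢0 (*-zeroProduct (trans (sym (insertAt-punchIn (λ t → a * μ t) p piv t)) e) a≢0)) ,
  vanish
  where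
  open +-*-Solver
  a = v p zero
  u : Fin (suc m) → Pt (suc m)
  u t = v (punchIn p t)
  S = sumF (λ t → μ t * u t zero)
  -- In the relation `μ` among the reduced vectors, `u t` occurs with coefficient `a * μ t`, and the
  -- multiples of `v p` collect to `- S`.
  piv = - S
  ν = insertAt (λ t → a * μ t) p piv
  expand : ∀ k → comb ν v k ≡ piv * v p k + a * sumF (λ t → μ t * u t k)
  expand k = trans (sumF-punchIn (λ t → ν t * v t k) p)
    (cong₂ _+_ (cong (_* v p k) (insertAt-lookup (λ t → a * μ t) p piv))
      (trans (sumF-cong (λ t → trans (cong (_* u t k) (insertAt-punchIn (λ t → a * μ t) p piv t))
                                     (ℚ.*-assoc a (μ t) (u t k))))
             (sumF-*ˡ a (λ t → μ t * u t k))))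
  vanish : ∀ k → comb ν v k ≡ 0ℚ
  vanish zero = trans (expand zero)
    (solve 2 (λ s a → :- s :* a :+ a :* s := con 0ℚ) refl S a)
  vanish (suc k) = trans (expand (suc k)) (begin
    - S * v p (suc k) + a * sumF (λ t → μ t * u t (suc k))
      ≡⟨ solve 4 (λ s y a r → :- s :* y :+ a :* r := a :* r :+ s :* (:- y)) refl S (v p (suc k)) a (sumF (λ t → μ t * u t (suc k))) ⟩
    a * sumF (λ t → μ t * u t (suc k)) + S * (- v p (suc k))
      ≡⟨ cong₂ _+_ (sumF-*ˡ a (λ t → μ t * u t (suc k))) (sumF-*ʳ (- v p (suc k)) (λ t → μ t * u t zero)) ⟨
    sumF (λ t → a * (μ t * u t (suc k))) + sumF (λ t → μ t * u t zero * (- v p (suc k)))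
      ≡⟨ sumF-+ (λ t → a * (μ t * u t (suc k))) (λ t → μ t * u t zero * (- v p (suc k))) ⟨
    sumF (λ t → a * (μ t * u t (suc k)) + μ t * u t zero * (- v p (suc k)))
      ≡⟨ sumF-cong (λ t → solve 5 (λ a m x z y → a :* (m :* x) :+ m :* z :* (:- y) := m :* (a :* x :- z :* y)) refl
            a (μ t) (u t (suc k)) (u t zero) (v p (suc k))) ⟩
    sumF (λ t → μ t * (a * u t (suc k) - u t zero * v p (suc k)))
      ≡⟨ h k ⟩
    0ℚ ∎)

s2≡0⇒s≡0 : ∀ {s} → s * 2ℚ ≡ 0ℚ → s ≡ 0ℚ
s2≡0⇒s≡0 {s} e = p+p≡0⇒p≡0 (trans (solve 1 (λ s → s :+ s := s :* con 2ℚ) refl s) e)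
  where open +-*-Solver

-- Every point has mass 2, so pairing a linear dependency with `𝟙` shows that its coefficients sum
-- to zero: it is an affine dependency.
¬AffInd-simplex : ∀ {n} (v : Fin (suc n) → Pt n) → (∀ t → 𝟙 · v t ≡ 2ℚ) → ¬ AffInd v
¬AffInd-simplex {n} v h2 aff with dependent n v
... | μ , (t , μt≢0) , h = μt≢0 (aff μ (s2≡0⇒s≡0 (trans (sym (comb-dot μ v 𝟙 h2))
  (sumF-zero (λ k → trans (ℚ.*-identityˡ (comb μ v k)) (h k))))) h t)

-- Dropping coordinate `p` leaves one coordinate fewer than points, so some nontrivial combination
-- is supported at `p`. Pairing it with `𝟙` and `c` gives `2s` and `β s` for the coefficient sum
-- `s`, which forces `s = 0` as `c p * 2` differs from `β`.
¬AffInd-1 : ∀ {m} (v : Fin (suc m) → Pt (suc m)) (c : Pt (suc m)) {β} p →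
  (∀ t → 𝟙 · v t ≡ 2ℚ) → (∀ t → c · v t ≡ β) → c p * 2ℚ ≢ β → ¬ AffInd v
¬AffInd-1 {m} v c {β} p h2 hc ne aff with dependent m (λ t k → v t (punchIn p k))
... | μ , (t , μt≢0) , h = μt≢0 (aff μ s≡0 vanish t)
  where
  open +-*-Solver
  s = sumF μ
  V = comb μ v
  off : ∀ k → k ≢ p → V k ≡ 0ℚ
  off k k≢p = trans (cong V (sym (punchIn-punchOut (k≢p ∘ sym)))) (h (punchOut (k≢p ∘ sym)))
  dotV : ∀ d → d · V ≡ d p * V p
  dotV d = sumF-single p (λ k k≢p → trans (cong (d k *_) (off k k≢p)) (ℚ.*-zeroʳ (d k)))
  Vp : V p ≡ s * 2ℚ
  Vp = trans (sym (ℚ.*-identityˡ (V p))) (trans (sym (dotV 𝟙)) (comb-dot μ v 𝟙 h2))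
  s≡0 : s ≡ 0ℚ
  s≡0 = *-zeroProduct {c p * 2ℚ - β} (begin
    (c p * 2ℚ - β) * s
      ≡⟨ solve 3 (λ c β s → (c :* con 2ℚ :- β) :* s := c :* (s :* con 2ℚ) :- s :* β) refl (c p) β s ⟩
    c p * (s * 2ℚ) - s * β
      ≡⟨ cong₂ _-_ (trans (cong (c p *_) (sym Vp)) (sym (dotV c))) (sym (comb-dot μ v c hc)) ⟩
    c · V - c · V
      ≡⟨ ℚ.+-inverseʳ (c · V) ⟩
    0ℚ ∎) (ne ∘ p-q≡0⇒p≡q)
  vanish : ∀ k → V k ≡ 0ℚ
  vanish k with k ≟ p
  ... | no k≢p   = off k k≢p
  ... | yes refl = trans Vp (trans (cong (_* 2ℚ) s≡0) (ℚ.*-zeroˡ 2ℚ))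

-- Here `p` and `q` are dropped. Pairing with `X`, `Y` and `𝟙` gives `V p = s`, `V p + V q = s` and
-- `V p + V q = 2s`; the last two yield `s = 0`, and then both coordinates vanish.
¬AffInd-2 : ∀ {m} (v : Fin (suc m) → Pt (suc (suc m))) (X Y : Fin (suc (suc m)) → Bool) {p q} →
  X p ≡ true → X q ≡ false → Y p ≡ true → Y q ≡ true →
  (∀ t → 𝟙 · v t ≡ 2ℚ) → (∀ t → χ X · v t ≡ 1ℚ) → (∀ t → χ Y · v t ≡ 1ℚ) → ¬ AffInd v
¬AffInd-2 {m} v X Y {p} {q} Xp Xq Yp Yq h2 hX hY aff
  with dependent m (λ t k → v t (punchIn p (punchIn (punchOut {i = p} {q} (λ { refl → case trans (sym Xp) Xq of λ () })) k)))
... | μ , (t , μt≢0) , h = μt≢0 (aff μ s≡0 vanish t)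
  where
  open +-*-Solver
  p≢q : p ≢ q
  p≢q refl = case trans (sym Xp) Xq of λ ()
  s = sumF μ
  V = comb μ v
  off : ∀ k → k ≢ p → k ≢ q → V k ≡ 0ℚ
  off k k≢p k≢q = trans (cong V (sym (trans (cong (punchIn p) (punchIn-punchOut q≢k')) (punchIn-punchOut (k≢p ∘ sym)))))
                    (h (punchOut q≢k'))
    where
    q≢k' : punchOut p≢q ≢ punchOut (k≢p ∘ sym)
    q≢k' e = k≢q (sym (punchOut-injective p≢q (k≢p ∘ sym) e))
  dotV : ∀ d {x y} → d p ≡ x → d q ≡ y → d · V ≡ x * V p + y * V q
  dotV d refl refl = sumF-pair p q p≢q (λ k k≢p k≢q → trans (cong (d k *_) (off k k≢p k≢q)) (ℚ.*-zeroʳ (d k)))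
  e₁ : 1ℚ * V p + 0ℚ * V q ≡ s * 1ℚ
  e₁ = trans (sym (dotV (χ X) (χ-true X Xp) (χ-false X Xq))) (comb-dot μ v (χ X) hX)
  e₂ : 1ℚ * V p + 1ℚ * V q ≡ s * 1ℚ
  e₂ = trans (sym (dotV (χ Y) (χ-true Y Yp) (χ-true Y Yq))) (comb-dot μ v (χ Y) hY)
  e₃ : 1ℚ * V p + 1ℚ * V q ≡ s * 2ℚ
  e₃ = trans (sym (dotV 𝟙 refl refl)) (comb-dot μ v 𝟙 h2)
  s≡0 : s ≡ 0ℚ
  s≡0 = trans (solve 1 (λ s → s := s :* con 2ℚ :- s :* con 1ℚ) refl s)
    (trans (cong₂ _-_ (sym e₃) (sym e₂)) (ℚ.+-inverseʳ (1ℚ * V p + 1ℚ * V q)))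
  Vp≡0 : V p ≡ 0ℚ
  Vp≡0 = trans (solve 2 (λ p q → p := con 1ℚ :* p :+ con 0ℚ :* q) refl (V p) (V q))
           (trans e₁ (cong (_* 1ℚ) s≡0))
  Vq≡0 : V q ≡ 0ℚ
  Vq≡0 = trans (solve 2 (λ p q → q := con 1ℚ :* p :+ con 1ℚ :* q :- p) refl (V p) (V q))
           (cong₂ _-_ (trans e₂ (cong (_* 1ℚ) s≡0)) Vp≡0)
  vanish : ∀ k → V k ≡ 0ℚ
  vanish k with k ≟ p | k ≟ q
  ... | yes refl | _        = Vp≡0
  ... | no _     | yes refl = Vq≡0
  ... | no k≢p   | no k≢q   = off k k≢p k≢q

ind-left : ∀ {n} (i j : Fin n) → ind i j i ≡ 1ℚ
ind-left i j with i ≟ i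
... | yes _ = refl
... | no ne = ⊥-elim (ne refl)

ind-right : ∀ {n} (i j : Fin n) → ind i j j ≡ 1ℚ
ind-right i j with j ≟ i | j ≟ j
... | yes _ | _     = refl
... | no _  | yes _ = refl
... | no _  | no ne = ⊥-elim (ne refl)

ind-off : ∀ {n} {i j k : Fin n} → k ≢ i → k ≢ j → ind i j k ≡ 0ℚ
ind-off {i = i} {j} {k} k≢i k≢j with k ≟ i | k ≟ j
... | yes e | _     = ⊥-elim (k≢i e)
... | no _  | yes e = ⊥-elim (k≢j e)
... | no _  | no _  = refl

module _ {m n} (μ : Fin m → ℚ) (v : Fin m → Pt n) where

  -- Coordinate `k` of the combination consists of the single term at `t`. For edge vectors this
  -- strips leaves one after another.
  peel : comb μ v ≗ (λ _ → 0ℚ) → ∀ k {t} → v t k ≡ 1ℚ → (∀ s → s ≢ t → μ s ≡ 0ℚ ⊎ v s k ≡ 0ℚ) → μ t ≡ 0ℚ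
  peel V≡0 k {t} one h = begin
    μ t            ≡⟨ ℚ.*-identityʳ (μ t) ⟨
    μ t * 1ℚ       ≡⟨ cong (μ t *_) one ⟨
    μ t * v t k    ≡⟨ sumF-single t (λ s s≢t → off s (h s s≢t)) ⟨
    comb μ v k     ≡⟨ V≡0 k ⟩
    0ℚ ∎
    where
    off : ∀ s → μ s ≡ 0ℚ ⊎ v s k ≡ 0ℚ → μ s * v s k ≡ 0ℚ
    off s (inj₁ e) = trans (cong (_* v s k) e) (ℚ.*-zeroˡ (v s k))
    off s (inj₂ e) = trans (cong (μ s *_) e) (ℚ.*-zeroʳ (μ s))

  -- The same with the affine functional 1 - x_k in place of the coordinate x_k.
  co-peel : sumF μ ≡ 0ℚ → comb μ v ≗ (λ _ → 0ℚ) → ∀ k {t} → v t k ≡ 0ℚ →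
    (∀ s → s ≢ t → μ s ≡ 0ℚ ⊎ v s k ≡ 1ℚ) → μ t ≡ 0ℚ
  co-peel s≡0 V≡0 k {t} nil h = begin
    μ t                                      ≡⟨ solve 1 (λ m → m := m :+ con (- 1ℚ) :* (m :* con 0ℚ)) refl (μ t) ⟩
    μ t + - 1ℚ * (μ t * 0ℚ)                  ≡⟨ cong (λ z → μ t + - 1ℚ * (μ t * z)) nil ⟨
    μ t + - 1ℚ * (μ t * v t k)               ≡⟨ sumF-single t (λ s s≢t → off s (h s s≢t)) ⟨
    sumF (λ s → μ s + - 1ℚ * (μ s * v s k))  ≡⟨ sumF-+ μ _ ⟩
    sumF μ + sumF (λ s → - 1ℚ * (μ s * v s k)) ≡⟨ cong₂ _+_ s≡0 (trans (sumF-*ˡ (- 1ℚ) (λ s → μ s * v s k)) (cong (- 1ℚ *_) (V≡0 k))) ⟩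
    0ℚ ∎
    where
    open +-*-Solver
    off : ∀ s → μ s ≡ 0ℚ ⊎ v s k ≡ 1ℚ → μ s + - 1ℚ * (μ s * v s k) ≡ 0ℚ
    off s (inj₁ e) rewrite e = solve 1 (λ v → con 0ℚ :+ con (- 1ℚ) :* (con 0ℚ :* v) := con 0ℚ) refl (v s k)
    off s (inj₂ e) rewrite e = solve 1 (λ m → m :+ con (- 1ℚ) :* (m :* con 1ℚ) := con 0ℚ) refl (μ s)

-- The edges {t, g t} form a double star with centres a and b.
doubleStar-AffInd : ∀ {m n} (ι : Fin m → Fin n) → (∀ {s t} → ι s ≡ ι t → s ≡ t) →
  ∀ a b → (∀ t → ι t ≢ a) → (g : Fin n → Fin n) → (∀ t → g t ≡ a ⊎ g t ≡ b) →
  AffInd (λ t → ind (ι t) (g (ι t)))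
doubleStar-AffInd ι inj a b ι≢a g g∈ μ s≡0 V≡0 t = all t
  where
  edge = λ t → ind (ι t) (g (ι t))
  leaf : ∀ t → ι t ≢ b → μ t ≡ 0ℚ
  leaf t ι≢b = peel μ edge V≡0 (ι t) (ind-left (ι t) (g (ι t))) (λ s s≢t → inj₂ (ind-off (s≢t ∘ sym ∘ inj) (off (g∈ (ι s)))))
    where
    off : ∀ {r} → r ≡ a ⊎ r ≡ b → ι t ≢ r
    off (inj₁ refl) = ι≢a t
    off (inj₂ refl) = ι≢b
  all : ∀ t → μ t ≡ 0ℚ
  all t with ι t ≟ b
  ... | no ne = leaf t ne
  ... | yes e = peel μ edge V≡0 (ι t) (ind-left (ι t) (g (ι t))) (λ s s≢t → inj₁ (leaf s (λ e' → s≢t (inj (trans e' (sym e))))))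

-- The edges {t, f t} form a triangle u, v, w with pendant edges attached to it.
triangle-AffInd : ∀ {n} (u v w : Fin n) → u ≢ v → v ≢ w → u ≢ w → (f : Fin n → Fin n) →
  f u ≡ v → f v ≡ w → f w ≡ u → (∀ t → f t ≡ u ⊎ f t ≡ v ⊎ f t ≡ w) →
  AffInd (λ t → ind t (f t))
triangle-AffInd u v w u≢v v≢w u≢w f fu fv fw f∈ μ s≡0 V≡0 t = all t
  where
  edge = λ t → ind t (f t)
  pendant : ∀ t → t ≢ u → t ≢ v → t ≢ w → μ t ≡ 0ℚ
  pendant t t≢u t≢v t≢w = peel μ edge V≡0 t (ind-left t (f t)) (λ s s≢t → inj₂ (ind-off (s≢t ∘ sym) (off (f∈ s))))
    where
    off : ∀ {r} → r ≡ u ⊎ r ≡ v ⊎ r ≡ w → t ≢ r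
    off (inj₁ refl) = t≢u
    off (inj₂ (inj₁ refl)) = t≢v
    off (inj₂ (inj₂ refl)) = t≢w
  indf : ∀ {s r} → f s ≡ r → ind s (f s) r ≡ 1ℚ
  indf {s} refl = ind-right s (f s)
  indf-off : ∀ {s r k} → f s ≡ r → k ≢ s → k ≢ r → ind s (f s) k ≡ 0ℚ
  indf-off refl = ind-off
  all : ∀ t → μ t ≡ 0ℚ
  all t with t ≟ u | t ≟ v | t ≟ w
  ... | no tu | no tv | no tw = pendant t tu tv tw
  -- Of the three triangle edges only uv misses `w`, so `1 - x_w` isolates it; the other two are
  -- treated in the same way at `u` and `v`.
  ... | yes refl | _ | _ = co-peel μ edge s≡0 V≡0 w (indf-off fu (u≢w ∘ sym) (v≢w ∘ sym)) others
    where
    others : ∀ s → s ≢ u → μ s ≡ 0ℚ ⊎ ind s (f s) w ≡ 1ℚ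
    others s su with s ≟ v | s ≟ w
    ... | yes refl | _ = inj₂ (indf fv)
    ... | no _ | yes refl = inj₂ (ind-left w (f w))
    ... | no sv | no sw = inj₁ (pendant s su sv sw)
  ... | no _ | yes refl | _ = co-peel μ edge s≡0 V≡0 u (indf-off fv u≢v u≢w) others
    where
    others : ∀ s → s ≢ v → μ s ≡ 0ℚ ⊎ ind s (f s) u ≡ 1ℚ
    others s sv with s ≟ u | s ≟ w
    ... | yes refl | _ = inj₂ (ind-left u (f u))
    ... | no _ | yes refl = inj₂ (indf fw)
    ... | no su | no sw = inj₁ (pendant s su sv sw)
  ... | no _ | no _ | yes refl = co-peel μ edge s≡0 V≡0 v (indf-off fw v≢w (u≢v ∘ sym)) others
    where
    others : ∀ s → s ≢ w → μ s ≡ 0ℚ ⊎ ind s (f s) v ≡ 1ℚ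
    others s sw with s ≟ u | s ≟ v
    ... | yes refl | _ = inj₂ (indf fu)
    ... | no _ | yes refl = inj₂ (ind-left v (f v))
    ... | no su | no sv = inj₁ (pendant s su sv sw)

-- Complementary masses and rebalancing of weights

χ+χ-not : ∀ {n} (A : Fin n → Bool) k → χ A k + χ (not ∘ A) k ≡ 1ℚ
χ+χ-not A k with A k
... | true  = refl
... | false = refl

dot-+ : ∀ {n} (c d x : Pt n) → (λ k → c k + d k) · x ≡ c · x + d · x
dot-+ c d x = trans (sumF-cong (λ k → ℚ.*-distribʳ-+ (x k) (c k) (d k))) (sumF-+ (λ k → c k * x k) _)

χ-dot-compl : ∀ {n} (A : Fin n → Bool) {x : Pt n} → sumF x ≡ 2ℚ → χ A · x + χ (not ∘ A) · x ≡ 2ℚ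
χ-dot-compl A {x} e = trans (sym (dot-+ (χ A) (χ (not ∘ A)) x))
  (trans (sumF-cong (λ k → trans (cong (_* x k) (χ+χ-not A k)) (ℚ.*-identityˡ (x k)))) e)

-- Rebalancing: the weight α of the edges inside P is at most the weight β of the edges outside P,
-- so ij + uv = iu + jv trades every inside edge ij, against a proportional share of the outside
-- edges uv, for crossing edges.
module Rebalance {n} {B : Fin n → Fin n → Bool} {x : Pt n} (W : Weights B x) (P : Fin n → Bool)
  (P≤1 : χ P · x ≤ 1ℚ) where
  open Weights W
  open +-*-Solver

  p q Pw Qw s t : Pt n
  p = χ P
  q = χ (not ∘ P)
  Pw a = sumF (λ b → p b * w a b)
  Qw a = sumF (λ b → q b * w a b)
  s a = p a * Pw a
  t a = q a * Qw a

  α β : ℚ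
  α = sumF s
  β = sumF t

  p-nonneg : ∀ a → 0ℚ ≤ p a
  p-nonneg = χ-nonneg P
  q-nonneg : ∀ a → 0ℚ ≤ q a
  q-nonneg = χ-nonneg (not ∘ P)
  s-nonneg : ∀ a → 0ℚ ≤ s a
  s-nonneg a = *-nonneg (p-nonneg a) (sumF-nonneg (λ b → *-nonneg (p-nonneg b) (nonneg a b)))
  t-nonneg : ∀ a → 0ℚ ≤ t a
  t-nonneg a = *-nonneg (q-nonneg a) (sumF-nonneg (λ b → *-nonneg (q-nonneg b) (nonneg a b)))

  x≡P+Q : ∀ a → x a ≡ Pw a + Qw a
  x≡P+Q a = begin
    x a                                      ≡⟨ degree a ⟩
    sumF (w a)                               ≡⟨ sumF-cong split ⟩
    sumF (λ b → p b * w a b + q b * w a b)   ≡⟨ sumF-+ (λ b → p b * w a b) (λ b → q b * w a b) ⟩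
    Pw a + Qw a ∎
    where
    split : ∀ b → w a b ≡ p b * w a b + q b * w a b
    split b = trans (sym (ℚ.*-identityˡ (w a b)))
      (trans (cong (_* w a b) (sym (χ+χ-not P b))) (ℚ.*-distribʳ-+ (w a b) (p b) (q b)))

  γ : ℚ
  γ = sumF (λ a → p a * Qw a)

  γ-sym : sumF (λ a → q a * Pw a) ≡ γ
  γ-sym = begin
    sumF (λ a → q a * Pw a)
      ≡⟨ sumF-cong (λ a → sym (sumF-*ˡ (q a) (λ b → p b * w a b))) ⟩
    sumF (λ a → sumF (λ b → q a * (p b * w a b)))
      ≡⟨ sumF-swap (λ a b → q a * (p b * w a b)) ⟩
    sumF (λ b → sumF (λ a → q a * (p b * w a b)))
      ≡⟨ sumF-cong (λ b → sumF-cong (λ a → trans (rot (q a) (p b) (w a b)) (cong (λ z → p b * (q a * z)) (w-sym a b)))) ⟩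
    sumF (λ b → sumF (λ a → p b * (q a * w b a)))
      ≡⟨ sumF-cong (λ b → sumF-*ˡ (p b) (λ a → q a * w b a)) ⟩
    γ ∎
    where
    rot : ∀ a b d → a * (b * d) ≡ b * (a * d)
    rot = solve 3 (λ a b d → a :* (b :* d) := b :* (a :* d)) refl

  p-dot : p · x ≡ α + γ
  p-dot = trans (sumF-cong (λ a → trans (cong (p a *_) (x≡P+Q a)) (ℚ.*-distribˡ-+ (p a) (Pw a) (Qw a))))
    (sumF-+ s (λ a → p a * Qw a))

  q-dot : q · x ≡ β + γ
  q-dot = trans (sumF-cong (λ a → trans (cong (q a *_) (trans (x≡P+Q a) (ℚ.+-comm (Pw a) (Qw a)))) (ℚ.*-distribˡ-+ (q a) (Qw a) (Pw a))))
    (trans (sumF-+ t (λ a → q a * Pw a)) (cong (β +_) γ-sym))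

  -- The crossing weight `γ` enters both `p · x` and `q · x`, so `β - α` equals `q · x - p · x`,
  -- that is `2 (1 - p · x)`.
  α≤β : α ≤ β
  α≤β = 0≤q-p⇒p≤q (subst (0ℚ ≤_) eq (+-nonneg h h))
    where
    h : 0ℚ ≤ 1ℚ - p · x
    h = p≤q⇒0≤q-p P≤1
    eq : (1ℚ - p · x) + (1ℚ - p · x) ≡ β - α
    eq = begin
      (1ℚ - p · x) + (1ℚ - p · x)
        ≡⟨ solve 1 (λ y → (con 1ℚ :- y) :+ (con 1ℚ :- y) := con 2ℚ :- y :- y) refl (p · x) ⟩
      2ℚ - p · x - p · x
        ≡⟨ cong (λ z → z - p · x - p · x) (sym (χ-dot-compl P total)) ⟩
      (p · x + q · x) - p · x - p · x
        ≡⟨ solve 2 (λ y z → (y :+ z) :- y :- y := z :- y) refl (p · x) (q · x) ⟩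
      q · x - p · x
        ≡⟨ cong₂ _-_ q-dot p-dot ⟩
      (β + γ) - (α + γ)
        ≡⟨ solve 3 (λ α β γ → (β :+ γ) :- (α :+ γ) := β :- α) refl α β γ ⟩
      β - α ∎

  α-nonneg : 0ℚ ≤ α
  α-nonneg = sumF-nonneg s-nonneg

  -- The rate is `1 / β`. If `β` is zero, then so are `α` and every `s a`, and rate 0 does.
  rate : Σ ℚ λ r → 0ℚ ≤ r × 0ℚ ≤ 1ℚ - α * r × (∀ a → r * β * s a ≡ s a)
  rate with β ℚ.≟ 0ℚ
  ... | yes β≡0 = 0ℚ , ℚ.≤-refl ,
      subst (0ℚ ≤_) (solve 1 (λ α → con 1ℚ := con 1ℚ :- α :* con 0ℚ) refl α) (from-yes (0ℚ ℚ.≤? 1ℚ)) ,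
      λ a → trans (solve 2 (λ β s → con 0ℚ :* β :* s := con 0ℚ) refl β (s a)) (sym (s≡0 a))
    where
    s≡0 : ∀ a → s a ≡ 0ℚ
    s≡0 = sumF-nonneg≡0 s-nonneg (ℚ.≤-antisym (subst (α ≤_) β≡0 α≤β) α-nonneg)
  ... | no β≢0 = r , r-nonneg ,
      subst (0ℚ ≤_) (trans (solve 3 (λ α β r → (β :- α) :* r := r :* β :- α :* r) refl α β r)
                           (cong (λ z → z - α * r) rβ≡1)) (*-nonneg (p≤q⇒0≤q-p α≤β) r-nonneg) ,
      λ a → trans (cong (_* s a) rβ≡1) (ℚ.*-identityˡ (s a))
    where
    β>0 : 0ℚ < β
    β>0 = ℚ.≰⇒> (λ β≤0 → β≢0 (ℚ.≤-antisym β≤0 (ℚ.≤-trans α-nonneg α≤β)))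
    instance β-pos = positive β>0
    instance β-nonZero = ℚ.pos⇒nonZero β
    r = 1/ β
    rβ≡1 : r * β ≡ 1ℚ
    rβ≡1 = ℚ.*-inverseˡ β
    r-nonneg : 0ℚ ≤ r
    r-nonneg = ℚ.<⇒≤ (ℚ.positive⁻¹ r {{ℚ.1/pos⇒pos β}})

  r = proj₁ rate
  κ = 1ℚ - α * r

  -- Outside edges keep the fraction `κ` of their weight, crossing edges keep all of it, and the
  -- traded weight goes to crossing pairs in proportion to the inside degree `s` of one end and the
  -- outside degree `t` of the other. Pairs inside `P` receive nothing.
  w' : Fin n → Fin n → ℚ
  w' a b = ((q a * κ) * (q b * w a b) + (p a * (q b * w a b) + q a * (p b * w a b)))
         + ((r * s a) * t b + (r * t a) * s b)

  w'-nonneg : ∀ a b → 0ℚ ≤ w' a b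
  w'-nonneg a b = +-nonneg
    (+-nonneg (*-nonneg (*-nonneg (q-nonneg a) (proj₁ (proj₂ (proj₂ rate)))) (*-nonneg (q-nonneg b) (nonneg a b)))
      (+-nonneg (*-nonneg (p-nonneg a) (*-nonneg (q-nonneg b) (nonneg a b)))
                (*-nonneg (q-nonneg a) (*-nonneg (p-nonneg b) (nonneg a b)))))
    (+-nonneg (*-nonneg (*-nonneg r≥0 (s-nonneg a)) (t-nonneg b))
              (*-nonneg (*-nonneg r≥0 (t-nonneg a)) (s-nonneg b)))
    where r≥0 = proj₁ (proj₂ rate)

  w'-sym : ∀ a b → w' a b ≡ w' b a
  w'-sym a b = trans
    (solve 11 (λ pa pb qa qb κ w sa sb ta tb r →
       ((qa :* κ) :* (qb :* w) :+ (pa :* (qb :* w) :+ qa :* (pb :* w))) :+ ((r :* sa) :* tb :+ (r :* ta) :* sb)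
       := ((qb :* κ) :* (qa :* w) :+ (pb :* (qa :* w) :+ qb :* (pa :* w))) :+ ((r :* sb) :* ta :+ (r :* tb) :* sa))
       refl (p a) (p b) (q a) (q b) κ (w a b) (s a) (s b) (t a) (t b) r)
    (cong (λ z → ((q b * κ) * (q a * z) + (p b * (q a * z) + q b * (p a * z)))
         + ((r * s b) * t a + (r * t b) * s a)) (w-sym a b))

  w'-degree : ∀ k → x k ≡ sumF (w' k)
  w'-degree k = sym (begin
    sumF (w' k)
      ≡⟨ sumF-+ (λ b → (q k * κ) * (q b * w k b) + (p k * (q b * w k b) + q k * (p b * w k b))) _ ⟩
    sumF (λ b → (q k * κ) * (q b * w k b) + (p k * (q b * w k b) + q k * (p b * w k b)))
      + sumF (λ b → (r * s k) * t b + (r * t k) * s b)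
      ≡⟨ cong₂ _+_
           (trans (sumF-+ (λ b → (q k * κ) * (q b * w k b)) _)
             (cong₂ _+_ (sumF-*ˡ (q k * κ) (λ b → q b * w k b))
               (trans (sumF-+ (λ b → p k * (q b * w k b)) _)
                 (cong₂ _+_ (sumF-*ˡ (p k) (λ b → q b * w k b)) (sumF-*ˡ (q k) (λ b → p b * w k b))))))
           (trans (sumF-+ (λ b → (r * s k) * t b) _)
             (cong₂ _+_ (sumF-*ˡ (r * s k) t) (sumF-*ˡ (r * t k) s))) ⟩
    ((q k * κ) * Qw k + (p k * Qw k + q k * Pw k)) + ((r * s k) * β + (r * t k) * α)
      ≡⟨ solve 8 (λ p q P Q α β r s →
           ((q :* (con 1ℚ :- α :* r)) :* Q :+ (p :* Q :+ q :* P)) :+ ((r :* s) :* β :+ (r :* (q :* Q)) :* α)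
           := (r :* β :* s) :+ (q :* Q :+ (p :* Q :+ q :* P))) refl (p k) (q k) (Pw k) (Qw k) α β r (s k) ⟩
    r * β * s k + (q k * Qw k + (p k * Qw k + q k * Pw k))
      ≡⟨ cong (_+ (q k * Qw k + (p k * Qw k + q k * Pw k))) (proj₂ (proj₂ (proj₂ rate)) k) ⟩
    p k * Pw k + (q k * Qw k + (p k * Qw k + q k * Pw k))
      ≡⟨ solve 4 (λ p q P Q → p :* P :+ (q :* Q :+ (p :* Q :+ q :* P)) := (p :+ q) :* (P :+ Q)) refl (p k) (q k) (Pw k) (Qw k) ⟩
    (p k + q k) * (Pw k + Qw k)
      ≡⟨ cong₂ _*_ (χ+χ-not P k) (sym (x≡P+Q k)) ⟩
    1ℚ * x k
      ≡⟨ ℚ.*-identityˡ (x k) ⟩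
    x k ∎)

  w'-inside : ∀ {a b} → P a ≡ true → P b ≡ true → w' a b ≡ 0ℚ
  w'-inside {a} {b} Pa Pb = trans
    (cong₂ (λ qa qb → ((qa * κ) * (qb * w a b) + (p a * (qb * w a b) + qa * (p b * w a b)))
         + ((r * s a) * (qb * Qw b) + (r * (qa * Qw a)) * s b)) (χ-false (not ∘ P) (cong not Pa)) (χ-false (not ∘ P) (cong not Pb)))
    (solve 9 (λ κ w pa pb r sa sb Qa Qb →
       ((con 0ℚ :* κ) :* (con 0ℚ :* w) :+ (pa :* (con 0ℚ :* w) :+ con 0ℚ :* (pb :* w)))
         :+ ((r :* sa) :* (con 0ℚ :* Qb) :+ (r :* (con 0ℚ :* Qa)) :* sb) := con 0ℚ)
       refl κ (w a b) (p a) (p b) r (s a) (s b) (Qw a) (Qw b))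

  w'-outside : ∀ {a b} → P a ≡ false → P b ≡ false → w a b ≡ 0ℚ → w' a b ≡ 0ℚ
  w'-outside {a} {b} Pa Pb w≡0 = trans
    (cong₂ (λ pa pb → ((q a * κ) * (q b * w a b) + (pa * (q b * w a b) + q a * (pb * w a b)))
         + ((r * (pa * Pw a)) * t b + (r * t a) * (pb * Pw b))) (χ-false P Pa) (χ-false P Pb))
    (trans (cong (λ z → ((q a * κ) * (q b * z) + (0ℚ * (q b * z) + q a * (0ℚ * z)))
         + ((r * (0ℚ * Pw a)) * t b + (r * t a) * (0ℚ * Pw b))) w≡0)
    (solve 8 (λ κ qa qb r ta tb Pa Pb →
       ((qa :* κ) :* (qb :* con 0ℚ) :+ (con 0ℚ :* (qb :* con 0ℚ) :+ qa :* (con 0ℚ :* con 0ℚ)))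
         :+ ((r :* (con 0ℚ :* Pa)) :* tb :+ (r :* ta) :* (con 0ℚ :* Pb)) := con 0ℚ)
       refl κ (q a) (q b) r (t a) (t b) (Pw a) (Pw b)))

  -- The trade may put weight on any crossing pair, edge of `B` or not, so `B'` has to contain all
  -- of these, besides the edges of `B` outside `P`.
  rebalance : ∀ {B'} → (∀ a b → B' a b ≡ false → P a ≡ P b × (P a ≡ true ⊎ B a b ≡ false)) → Weights B' x
  rebalance {B'} h = weights w' w'-nonneg w'-sym
    (λ a b e → supp' a b refl (sym (proj₁ (h a b e))) (proj₂ (h a b e))) w'-degree total
    where
    supp' : ∀ a b {u} → P a ≡ u → P b ≡ u → u ≡ true ⊎ B a b ≡ false → w' a b ≡ 0ℚ
    supp' a b {true}  ea eb _        = w'-inside ea eb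
    supp' a b {false} ea eb (inj₂ z) = w'-outside ea eb (supp a b z)

-- Complete multipartite graphs and their class inequalities

record Multipartite {n} (B : Fin n → Fin n → Bool) : Set where
  constructor multipartite
  field
    isGraph : Graph B
    cotrans : ∀ {a} b {c} → B a c ≡ true → B a b ≡ true ⊎ B b c ≡ true
  open Graph isGraph public

-- Distinct elements of a loopless matroid are parallel when they do not form a base, so this is the
-- parallel class of i.
cls : ∀ {n} → (Fin n → Fin n → Bool) → Fin n → Fin n → Bool
cls B i k = not (B i k)

module _ {n} {B : Fin n → Fin n → Bool} (MP : Multipartite B) where
  open Multipartite MP

  ≁-sym : ∀ {a b} → B a b ≡ false → B b a ≡ false
  ≁-sym {a} {b} e = trans (B-sym b a) e

  ∼-sym : ∀ {a b} → B a b ≡ true → B b a ≡ true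
  ∼-sym {a} {b} e = trans (B-sym b a) e

  ≁-trans : ∀ {a b c} → B a b ≡ false → B b c ≡ false → B a c ≡ false
  ≁-trans {a} {b} {c} e f with B a c in g
  ... | false = refl
  ... | true with cotrans b g
  ...   | inj₁ h = case trans (sym e) h of λ ()
  ...   | inj₂ h = case trans (sym f) h of λ ()

  ≁-∼ : ∀ {a b c} → B a b ≡ false → B b c ≡ true → B a c ≡ true
  ≁-∼ {a} {b} {c} e f with B a c in g
  ... | true = refl
  ... | false = case trans (sym f) (≁-trans (≁-sym e) g) of λ ()

  ≁-cong : ∀ {a b} → B a b ≡ false → ∀ k → B a k ≡ B b k
  ≁-cong {a} {b} e k with B b k in f
  ... | true  = ≁-∼ e f
  ... | false = ≁-trans e f

  cut : List (Fin n) → Fin n → Fin n → Bool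
  cut []      a b = not ⌊ a ≟ b ⌋
  cut (i ∷ L) a b = if cls B i a ∧ cls B i b then false else cut L a b

  ∼⇒cut : ∀ L a b → B a b ≡ true → cut L a b ≡ true
  ∼⇒cut [] a b e with a ≟ b
  ... | yes refl = case trans (sym e) (B-irrefl a) of λ ()
  ... | no _ = refl
  ∼⇒cut (i ∷ L) a b e with B i a in f | B i b in g
  ... | true  | _     = ∼⇒cut L a b e
  ... | false | true  = ∼⇒cut L a b e
  ... | false | false = case trans (sym e) (≁-trans (≁-sym f) g) of λ ()

  ≁⇒cut : ∀ {L a} b → a ∈ L → B a b ≡ false → cut L a b ≡ false
  ≁⇒cut {a = a} b (here refl) e rewrite B-irrefl a | e = refl
  ≁⇒cut {i ∷ L} {a} b (there m) e with cls B i a ∧ cls B i b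
  ... | true  = refl
  ... | false = ≁⇒cut b m e

  -- Clearing the class of `i` adds weight only to pairs that cross it. Such pairs join different
  -- classes, so a class cleared before is never refilled.
  cut-weights : ∀ {x} → Weights (λ a b → not ⌊ a ≟ b ⌋) x → (∀ i → χ (cls B i) · x ≤ 1ℚ) → ∀ L → Weights (cut L) x
  cut-weights W h []      = W
  cut-weights W h (i ∷ L) = Rebalance.rebalance (cut-weights W h L) (cls B i) (h i) ok
    where
    ok : ∀ a b → cut (i ∷ L) a b ≡ false → cls B i a ≡ cls B i b × (cls B i a ≡ true ⊎ cut L a b ≡ false)
    ok a b e with B i a in f | B i b in g | B a b in k
    ... | false | false | _     = refl , inj₁ refl
    ... | true  | true  | _     = refl , inj₂ e
    ... | true  | false | true  = case trans (sym e) (∼⇒cut L a b k) of λ ()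
    ... | false | true  | true  = case trans (sym e) (∼⇒cut L a b k) of λ ()
    ... | true  | false | false = case trans (sym f) (≁-trans g (≁-sym k)) of λ ()
    ... | false | true  | false = case trans (sym g) (≁-trans f k) of λ ()

  class-bounds⇒Weights : ∀ {x} → Weights (λ a b → not ⌊ a ≟ b ⌋) x → (∀ i → χ (cls B i) · x ≤ 1ℚ) → Weights B x
  class-bounds⇒Weights W h with cut-weights W h (allFin n)
  ... | weights w nn sm sp deg tot = weights w nn sm (λ a b e → sp a b (≁⇒cut b (∈-allFin a) e)) deg tot

-- Connected rank-2 matroids

true≢false : ∀ {b} → b ≡ true → b ≡ false → ⊥
true≢false e f = case trans (sym e) f of λ ()

record Connected {n} (B : Fin n → Fin n → Bool) : Set where
  constructor connected
  field
    isMultipartite : Multipartite B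
    triangle : ∃ λ u → ∃ λ v → ∃ λ w → B u v ≡ true × B v w ≡ true × B u w ≡ true
  open Multipartite isMultipartite public

  -- Of the three classes met by the triangle, at most one is the class of `i`.
  others : ∀ i → ∃₂ λ u v → B i u ≡ true × B i v ≡ true × B u v ≡ true
  others i with triangle
  ... | u , v , w , uv , vw , uw with B i u in iu | B i v in iv
  ...   | true  | true  = u , v , iu , iv , uv
  ...   | true  | false = u , w , iu , ≁-∼ isMultipartite iv vw , uw
  ...   | false | _     = v , w , ≁-∼ isMultipartite iu uv , ≁-∼ isMultipartite iu uw , vw

matroid-graph : ∀ {n} (M : Rank2Matroid n) → Graph (base M)
matroid-graph M = graph (irrefl M) (symm M)

total-mass : ∀ {n} {B : Fin n → Fin n → Bool} → Graph B → ∀ {x} → Conv B x → 𝟙 · x ≡ 2ℚ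
total-mass G {x} c = valid-≡ (Conv⇒Weights G c) 𝟙 (λ _ _ _ → refl)

χ-dot≤1 : ∀ {n} {B : Fin n → Fin n → Bool} → Multipartite B → ∀ i {x} → Conv B x → χ (cls B i) · x ≤ 1ℚ
χ-dot≤1 {B = B} mp i c = valid-≤ (Conv⇒Weights (Multipartite.isGraph mp) c) (χ (cls B i)) valid
  where
  valid : ∀ a b → B a b ≡ true → χ (cls B i) a + χ (cls B i) b ≤ 1ℚ
  valid a b ab with B i a in ia | B i b in ib
  ... | true  | true  = from-yes (0ℚ ℚ.≤? 1ℚ)
  ... | true  | false = ℚ.≤-refl
  ... | false | true  = ℚ.≤-refl
  ... | false | false = ⊥-elim (true≢false ab (≁-trans mp (≁-sym mp ia) ib))

vertex⇒edge : ∀ {n} {B : Fin n → Fin n → Bool} → Multipartite B → ∀ {i j} → i ≢ j → Conv B (ind i j) → B i j ≡ true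
vertex⇒edge {B = B} mp {i} {j} i≢j c with B i j in ij
... | true  = refl
... | false = ⊥-elim (2≰1 (subst (_≤ 1ℚ) (trans (ind-dot (χ (cls B i)) i≢j)
    (cong₂ _+_ (χ-true (cls B i) (cong not (Multipartite.B-irrefl mp i))) (χ-true (cls B i) (cong not ij))))
    (χ-dot≤1 mp i c)))
  where
  2≰1 : ¬ (2ℚ ≤ 1ℚ)
  2≰1 = from-no (2ℚ ℚ.≤? 1ℚ)

-- The witnesses form a spanning graph whose only cycle is a triangle, with one edge per element: an
-- element off the triangle is hung on `u`, or on `v` if it is parallel to `u`. The upper bound
-- comes from the equation `𝟙 · x = 2`.
connected⇒HasDim : ∀ {m} {B : Fin (suc m) → Fin (suc m) → Bool} → Connected B → HasDim (Conv B) m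
connected⇒HasDim {m} {B} C with Connected.triangle C
... | u , v , w , uv , vw , uw =
  ((λ t → ind t (f t)) , (λ t → vertex∈Conv B (f-edge t)) ,
   triangle-AffInd u v w (≢-of uv) (≢-of vw) (≢-of uw) f fu fv fw f∈) ,
  λ p p∈ → ¬AffInd-simplex p (λ t → total-mass isGraph (p∈ t))
  where
  open Connected C
  ≢-of : ∀ {a b} → B a b ≡ true → a ≢ b
  ≢-of = edge-≢ isGraph
  f : Fin (suc m) → Fin (suc m)
  f t with t ≟ u | t ≟ v | t ≟ w
  ... | yes _ | _     | _     = v
  ... | no _  | yes _ | _     = w
  ... | no _  | no _  | yes _ = u
  ... | no _  | no _  | no _  = if B t u then u else v
  f-edge : ∀ t → B t (f t) ≡ true
  f-edge t with t ≟ u | t ≟ v | t ≟ w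
  ... | yes refl | _     | _     = uv
  ... | no _  | yes refl | _     = vw
  ... | no _  | no _  | yes refl = ∼-sym isMultipartite uw
  ... | no _  | no _  | no _  with B t u in tu
  ...   | true  = tu
  ...   | false = ≁-∼ isMultipartite tu uv
  fu : f u ≡ v
  fu with u ≟ u
  ... | yes _ = refl
  ... | no ne = ⊥-elim (ne refl)
  fv : f v ≡ w
  fv with v ≟ u | v ≟ v
  ... | yes e | _     = ⊥-elim (≢-of uv (sym e))
  ... | no _  | yes _ = refl
  ... | no _  | no ne = ⊥-elim (ne refl)
  fw : f w ≡ u
  fw with w ≟ u | w ≟ v | w ≟ w
  ... | yes e | _     | _     = ⊥-elim (≢-of uw (sym e))
  ... | no _  | yes e | _     = ⊥-elim (≢-of vw (sym e))
  ... | no _  | no _  | yes _ = refl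
  ... | no _  | no _  | no ne = ⊥-elim (ne refl)
  f∈ : ∀ t → f t ≡ u ⊎ f t ≡ v ⊎ f t ≡ w
  f∈ t with t ≟ u | t ≟ v | t ≟ w
  ... | yes _ | _     | _     = inj₂ (inj₁ refl)
  ... | no _  | yes _ | _     = inj₂ (inj₂ refl)
  ... | no _  | no _  | yes _ = inj₁ refl
  ... | no _  | no _  | no _  with B t u
  ...   | true  = inj₁ refl
  ...   | false = inj₂ (inj₁ refl)

-- Full dimension leaves room for no equation besides `𝟙 · x = 2`. A loop would give `x_ℓ = 0`, and
-- having only two classes would give x(A) = 1 for each of them.
HasDim⇒connected : ∀ {m} (M : Rank2Matroid (suc m)) → HasDim (BP M) m → Connected (base M)
HasDim⇒connected {m} M ((p , p∈ , aff) , _) = connected mp tri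
  where
  B = base M
  G = matroid-graph M
  2≢0 : 1ℚ * 2ℚ ≢ 0ℚ
  2≢0 ()
  2≢1 : 1ℚ * 2ℚ ≢ 1ℚ
  2≢1 ()
  hyperplane : ∀ (c : Pt (suc m)) {β} k → (∀ a b → B a b ≡ true → c a + c b ≡ β) → c k * 2ℚ ≢ β → ⊥
  hyperplane c k h ne = ¬AffInd-1 p c k (λ t → total-mass G (p∈ t))
    (λ t → valid-≡ (Conv⇒Weights G (p∈ t)) c h) ne aff

  loopless : ∀ ℓ → ∃ λ j → B ℓ j ≡ true
  loopless ℓ with any? (λ j → B ℓ j Bool.≟ true)
  ... | yes r = r
  ... | no none = ⊥-elim (hyperplane (δ ℓ) ℓ off (subst (λ z → z * 2ℚ ≢ 0ℚ) (sym (δ-refl ℓ)) 2≢0))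
    where
    off : ∀ a b → B a b ≡ true → δ ℓ a + δ ℓ b ≡ 0ℚ
    off a b ab = cong₂ _+_ (δ-≢ {i = ℓ} {a} (λ { refl → none (b , ab) })) (δ-≢ {i = ℓ} {b} (λ { refl → none (a , trans (symm M b a) ab) }))

  cotr : ∀ {a} b {c} → B a c ≡ true → B a b ≡ true ⊎ B b c ≡ true
  cotr {a} b {c} ac with loopless b
  ... | d , bd with d ≟ a | d ≟ c
  ...   | yes refl | _        = inj₁ (trans (symm M a b) bd)
  ...   | no _     | yes refl = inj₂ bd
  -- Since `b` is not a loop it lies in the base bd; exchanging `d` against the base ac pairs `b`
  -- with `a` or `c`.
  ...   | no d≢a   | no d≢c with exchange M d b a c (trans (symm M d b) bd) ac d≢a d≢c
  ...     | _ , inj₁ refl , _ , _ , ba = inj₁ (trans (symm M a b) ba)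
  ...     | _ , inj₂ refl , _ , _ , bc = inj₂ bc

  mp : Multipartite B
  mp = multipartite G cotr

  tri : ∃ λ u → ∃ λ v → ∃ λ w → B u v ≡ true × B v w ≡ true × B u w ≡ true
  tri with nonempty M
  ... | u , v , uv with any? (λ w → (B v w Bool.≟ true) ×-dec (B u w Bool.≟ true))
  ...   | yes (w , vw , uw) = u , v , w , uv , vw , uw
  ...   | no none = ⊥-elim (hyperplane (χ (cls B u)) u crossing
              (subst (λ z → z * 2ℚ ≢ 1ℚ) (sym (χ-true (cls B u) (cong not (irrefl M u)))) 2≢1))
    where
    crossing : ∀ a b → B a b ≡ true → χ (cls B u) a + χ (cls B u) b ≡ 1ℚ
    crossing a b ab with B u a in ua | B u b in ub
    ... | true  | false = refl
    ... | false | true  = refl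
    ... | false | false = ⊥-elim (true≢false ab (≁-trans mp (≁-sym mp ua) ub))
    ... | true  | true with B v a in va | B v b in vb
    ...   | true  | _     = ⊥-elim (none (a , va , ua))
    ...   | false | true  = ⊥-elim (none (b , vb , ub))
    ...   | false | false = ⊥-elim (true≢false ab (≁-trans mp (≁-sym mp va) vb))

-- Covering classes, common faces and facets

Same : ∀ {n} → Rank2Matroid n → Rank2Matroid n → Set
Same M N = ∀ i j → base M i j ≡ base N i j

same? : ∀ {n} (M N : Rank2Matroid n) → Same M N ⊎ ∃₂ λ i j → base M i j ≢ base N i j
same? M N with any? (λ i → any? (λ j → ¬? (base M i j Bool.≟ base N i j)))
... | yes (i , j , ne) = inj₂ (i , j , ne)
... | no none = inj₁ (λ i j → decidable-stable (base M i j Bool.≟ base N i j) (λ ne → none (i , j , ne)))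

Same-⊆ : ∀ {n} {M N : Rank2Matroid n} → Same M N → ∀ x → BP M x → BP N x
Same-⊆ s x (lam , nn , sp , one , pt) = lam , nn , (λ i j e → sp i j (trans (s i j) e)) , one , pt

Same⇒≐ : ∀ {n} (M N : Rank2Matroid n) → Same M N → BP M ≐ BP N
Same⇒≐ M N s x = Same-⊆ {M = M} {N} s x , Same-⊆ {M = N} {M} (λ i j → sym (s i j)) x

≐⇒Same : ∀ {n} {M N : Rank2Matroid n} → Multipartite (base M) → Multipartite (base N) → BP M ≐ BP N → Same M N
≐⇒Same {M = M} {N} mpM mpN e i j with base M i j in m | base N i j in k
... | true  | true  = refl
... | false | false = refl
... | true  | false = ⊥-elim (true≢false (vertex⇒edge mpN (edge-≢ (matroid-graph M) m) (proj₁ (e _) (vertex∈Conv (base M) m))) k)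
... | false | true  = ⊥-elim (true≢false (vertex⇒edge mpM (edge-≢ (matroid-graph N) k) (proj₂ (e _) (vertex∈Conv (base N) k))) m)

-- The class of i in M and the class of j in N together cover [n].
Cover : ∀ {n} → Rank2Matroid n → Fin n → Rank2Matroid n → Fin n → Set
Cover M i N j = ∀ k → base M i k ≡ false ⊎ base N j k ≡ false

Cover-sym : ∀ {n} {M N : Rank2Matroid n} {i j} → Cover M i N j → Cover N j M i
Cover-sym c k with c k
... | inj₁ e = inj₂ e
... | inj₂ e = inj₁ e

dot-neg : ∀ {n} (c x : Pt n) → (λ k → - c k) · x ≡ - (c · x)
dot-neg c x = trans (sumF-cong (λ k → solve 2 (λ c x → :- c :* x := con (- 1ℚ) :* (c :* x)) refl (c k) (x k)))
  (trans (sumF-*ˡ (- 1ℚ) (λ k → c k * x k)) (solve 1 (λ d → con (- 1ℚ) :* d := :- d) refl (c · x)))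
  where open +-*-Solver

-- Let A and B be the covering classes of `M` and `N`. Every base of `M` meets B, as the complement
-- of B lies in A; hence x(B) ≥ 1 on `BP M`, whereas x(B) ≤ 1 on `BP N`. The bases of `M` tight for
-- x(B) = 1 cross B and so are bases of `N`: the intersection is exactly this face.
module CoverFace {n} (M N : Rank2Matroid n) (mpM : Multipartite (base M)) (mpN : Multipartite (base N))
  {i j} (cov : Cover M i N j) where

  c : Pt n
  c k = - χ (cls (base N) j) k

  c-valid : ∀ a b → base M a b ≡ true → c a + c b ≤ - 1ℚ
  c-valid a b ab with base N j a in ja | base N j b in jb | cov a | cov b
  ... | false | false | _ | _ = from-yes (- 1ℚ + - 1ℚ ℚ.≤? - 1ℚ)
  ... | false | true  | _ | _ = from-yes (- 1ℚ ℚ.≤? - 1ℚ)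
  ... | true  | false | _ | _ = from-yes (- 1ℚ ℚ.≤? - 1ℚ)
  ... | true  | true  | inj₁ ia | inj₁ ib = ⊥-elim (true≢false ab (≁-trans mpM (≁-sym mpM ia) ib))

  c-tight : ∀ a b → c a + c b ≡ - 1ℚ → base N a b ≡ true
  c-tight a b e with base N j a in ja | base N j b in jb
  ... | false | true  = ≁-∼ mpN (≁-sym mpN ja) jb
  ... | true  | false = ∼-sym mpN (≁-∼ mpN (≁-sym mpN jb) ja)
  c-tight a b () | false | false
  c-tight a b () | true  | true

  tight : ∀ {x} → BP M x → BP N x → c · x ≡ - 1ℚ
  tight {x} m k = ℚ.≤-antisym (valid-≤ (Conv⇒Weights (matroid-graph M) m) c c-valid)
    (subst (- 1ℚ ≤_) (sym (dot-neg (χ (cls (base N) j)) x)) (ℚ.neg-antimono-≤ (χ-dot≤1 mpN j k)))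

  class-mass : ∀ {x} → BP M x → BP N x → χ (cls (base N) j) · x ≡ 1ℚ
  class-mass {x} m k = ℚ.neg-injective (trans (sym (dot-neg (χ (cls (base N) j)) x)) (tight m k))

  face : IsFace (BP M ∩ BP N) (BP M)
  face = c , - 1ℚ , (λ x m → valid-≤ (Conv⇒Weights (matroid-graph M) m) c c-valid) ,
    λ x → (λ { (m , k) → m , tight m k }) ,
          (λ { (m , t) → m , Weights⇒Conv (matroid-graph N)
                 (restrict (Conv⇒Weights (matroid-graph M) m) c c-valid t (λ a b _ → c-tight a b)) })

IsFace-∩-swap : ∀ {n} {P Q R : PSet n} → IsFace (P ∩ Q) R → IsFace (Q ∩ P) R
IsFace-∩-swap (c , b , v , h) = c , b , v , λ x →
  (λ { (q , p) → proj₁ (h x) (p , q) }) , (λ r → let p , q = proj₂ (h x) r in q , p)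

cover⇒faces : ∀ {n} (M N : Rank2Matroid n) → Multipartite (base M) → Multipartite (base N) → ∀ {i j} → Cover M i N j →
  IsFace (BP M ∩ BP N) (BP M) × IsFace (BP M ∩ BP N) (BP N)
cover⇒faces M N mpM mpN {i} {j} cov =
  CoverFace.face M N mpM mpN {i} {j} cov ,
  IsFace-∩-swap {P = BP N} {BP M} {BP N}
    (CoverFace.face N M mpN mpM {j} {i} (Cover-sym {M = M} {N} {i} {j} cov))

both-tight : ∀ {p q r s β} → p + q ≡ β → r + s ≡ β → p + r ≤ β → q + s ≤ β → p + r ≡ β
both-tight {p} {q} {r} {s} {β} pq rs pr qs = ℚ.≤-antisym pr (0≤q-p⇒p≤q (subst (0ℚ ≤_) eq (p≤q⇒0≤q-p qs)))
  where
  open +-*-Solver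
  eq : β - (q + s) ≡ p + r - β
  eq = begin
    β - (q + s)               ≡⟨ solve 3 (λ β q s → β :- (q :+ s) := β :+ β :- (q :+ s) :- β) refl β q s ⟩
    β + β - (q + s) - β       ≡⟨ cong₂ (λ y z → y + z - (q + s) - β) (sym pq) (sym rs) ⟩
    p + q + (r + s) - (q + s) - β ≡⟨ solve 5 (λ p q r s β → p :+ q :+ (r :+ s) :- (q :+ s) :- β := p :+ r :- β) refl p q r s β ⟩
    p + r - β ∎

-- If i and j are parallel in N but not in M, an edge uv of M avoiding their class would give
-- ij + uv = iu + jv (or iv + ju) with the right-hand side in the common face, hence ij as well.
face⇒parallel : ∀ {n} (M N : Rank2Matroid n) → Multipartite (base M) → Multipartite (base N) →
  IsFace (BP M ∩ BP N) (BP M) → ∀ {i j} → base M i j ≡ true → base N i j ≡ false →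
  ∀ {u v} → base N i u ≡ true → base N i v ≡ true → base M u v ≡ false
face⇒parallel M N mpM mpN (c , β , valid , fc) {i} {j} ij i≁j {u} {v} iu iv with base M u v in uv
... | false = refl
... | true  = ⊥-elim (contra (Multipartite.cotrans mpM u ij))
  where
  edge : ∀ {a b} → base M a b ≡ true → base N a b ≡ true → c a + c b ≡ β
  edge {a} {b} m k = trans (sym (ind-dot c (edge-≢ (matroid-graph M) m)))
    (proj₂ (proj₁ (fc (ind a b)) (vertex∈Conv (base M) m , vertex∈Conv (base N) k)))
  bound : ∀ {a b} → base M a b ≡ true → c a + c b ≤ β
  bound {a} {b} m = subst (_≤ β) (ind-dot c (edge-≢ (matroid-graph M) m)) (valid (ind a b) (vertex∈Conv (base M) m))
  crossed : ∀ {u v} → base N i u ≡ true → base N i v ≡ true → base M u v ≡ true →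
    base M i u ≡ true → base M j v ≡ true → ⊥
  crossed {u} {v} iu iv uv iu' jv' = true≢false
    (vertex⇒edge mpN i≢j (proj₂ (proj₂ (fc (ind i j)) (vertex∈Conv (base M) ij ,
      trans (ind-dot c i≢j) (both-tight {c i} {c u} {c j} {c v} (edge iu' iu) (edge jv' (≁-∼ mpN (≁-sym mpN i≁j) iv)) (bound ij) (bound uv))))))
    i≁j
    where i≢j = edge-≢ (matroid-graph M) ij
  -- Of the two ways to re-pair the edges ij and uv, at least one uses edges of `M` only: if, say,
  -- `j` and `v` are parallel, then iv and ju are edges.
  contra : base M i u ≡ true ⊎ base M u j ≡ true → ⊥
  contra (inj₁ iu') with base M j v in jv
  ... | true  = crossed iu iv uv iu' jv
  ... | false = crossed iv iu (∼-sym mpM uv) (∼-sym mpM (≁-∼ mpM (≁-sym mpM jv) (∼-sym mpM ij)))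
                  (≁-∼ mpM jv (∼-sym mpM uv))
  contra (inj₂ uj) with base M i v in iv'
  ... | true  = crossed iv iu (∼-sym mpM uv) iv' (∼-sym mpM uj)
  ... | false = crossed iu iv uv (≁-∼ mpM iv' (∼-sym mpM uv)) (∼-sym mpM (≁-∼ mpM (≁-sym mpM iv') ij))

face⇒cover : ∀ {n} (M N : Rank2Matroid n) → Multipartite (base M) → Connected (base N) →
  IsFace (BP M ∩ BP N) (BP M) → ∀ {i j} → base M i j ≡ true → base N i j ≡ false →
  ∃ λ u → Cover M u N i
face⇒cover M N mpM CN fc {i} {j} ij i≁j with Connected.others CN i
... | u , _ , iu , _ = u , cov
  where
  cov : Cover M u N i
  cov k with base N i k in ik
  ... | false = inj₂ refl
  ... | true  = inj₁ (face⇒parallel M N mpM (Connected.isMultipartite CN) fc {i} {j} ij i≁j iu ik)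

-- Different matroids disagree on some pair, and the one that has it as a base supplies the face to
-- which the parallelism argument applies.
faces⇒cover : ∀ {n} (M N : Rank2Matroid n) → Connected (base M) → Connected (base N) →
  IsFace (BP M ∩ BP N) (BP M) → IsFace (BP M ∩ BP N) (BP N) → Same M N ⊎ ∃₂ λ i j → Cover M i N j
faces⇒cover M N CM CN fM fN with same? M N
... | inj₁ s = inj₁ s
... | inj₂ (i , j , ne) with base M i j in m | base N i j in k
...   | true  | true  = ⊥-elim (ne refl)
...   | false | false = ⊥-elim (ne refl)
...   | true  | false = let u , cov = face⇒cover M N (Connected.isMultipartite CM) CN fM m k
                        in inj₂ (u , i , cov)
...   | false | true  = let u , cov = face⇒cover N M (Connected.isMultipartite CN) CM (IsFace-∩-swap {P = BP M} {BP N} {BP N} fN) k m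
                        in inj₂ (i , u , Cover-sym {M = N} {M} {u} {i} cov)

-- Every point of the common face has mass 1 on both classes; if these overlapped, the face would
-- have codimension at least 2.
facet⇒opposite : ∀ {m} (M N : Rank2Matroid (suc (suc m))) → Connected (base M) → Connected (base N) →
  IsFace (BP M ∩ BP N) (BP M) → IsFace (BP M ∩ BP N) (BP N) → HasDim (BP M ∩ BP N) m →
  ∃₂ λ i j → ∀ k → base N j k ≡ not (base M i k)
facet⇒opposite M N CM CN fM fN ((p , p∈ , aff) , upper) with faces⇒cover M N CM CN fM fN
-- Equal matroids would meet in all of `BP M`, one dimension too many.
... | inj₁ s = ⊥-elim (upper v (λ t → v∈ t , Same-⊆ {M = M} {N} s (v t) (v∈ t)) vaff)
  where
  basis = proj₁ (connected⇒HasDim CM)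
  v = proj₁ basis
  v∈ = proj₁ (proj₂ basis)
  vaff = proj₂ (proj₂ basis)
... | inj₂ (i , j , cov) = i , j , opp
  where
  mpM = Connected.isMultipartite CM
  mpN = Connected.isMultipartite CN
  cov' : Cover N j M i
  cov' = Cover-sym {M = M} {N} {i} {j} cov
  disjoint : ∀ {k} → base M i k ≡ false → base N j k ≡ false → ⊥
  disjoint {k} ik jk with Connected.others CN j
  ... | q , _ , jq , _ with cov q
  ...   | inj₂ e  = true≢false jq e
  ...   | inj₁ iq = ¬AffInd-2 p (cls (base N) j) (cls (base M) i) {k} {q}
            (cong not jk) (cong not jq) (cong not ik) (cong not iq)
            (λ t → total-mass (matroid-graph M) (proj₁ (p∈ t)))
            (λ t → CoverFace.class-mass M N mpM mpN {i} {j} cov (proj₁ (p∈ t)) (proj₂ (p∈ t)))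
            (λ t → CoverFace.class-mass N M mpN mpM {j} {i} cov' (proj₂ (p∈ t)) (proj₁ (p∈ t))) aff
  opp : ∀ k → base N j k ≡ not (base M i k)
  opp k with base M i k in ik | base N j k in jk | cov k
  ... | true  | false | _ = refl
  ... | false | true  | _ = refl
  ... | false | false | _ = ⊥-elim (disjoint ik jk)
  ... | true  | true  | inj₁ ()
  ... | true  | true  | inj₂ ()

opposite⇒cover : ∀ {n} {M N : Rank2Matroid n} {i j} → (∀ k → base N j k ≡ not (base M i k)) → Cover M i N j
opposite⇒cover {M = M} {i = i} opp k with base M i k | opp k
... | false | _ = inj₁ refl
... | true  | e = inj₂ e

-- A pair crossing between the two opposite classes is a base of both matroids. Joining each element
-- to the centre, `i` or `j`, on the other side gives a spanning tree of such pairs, with one edge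
-- for each element other than `i`.
opposite⇒HasDim : ∀ {m} (M N : Rank2Matroid (suc (suc m))) → Multipartite (base M) → Multipartite (base N) →
  ∀ {i j} → (∀ k → base N j k ≡ not (base M i k)) → HasDim (BP M ∩ BP N) m
opposite⇒HasDim {m} M N mpM mpN {i} {j} opp =
  ((λ t → ind (ι t) (g (ι t))) , (λ t → vertex∈Conv (base M) (M-edge (ι t)) , vertex∈Conv (base N) (N-edge (ι t))) ,
   doubleStar-AffInd ι (punchIn-injective i _ _) i j (punchInᵢ≢i i) g g∈) ,
  λ v v∈ → ¬AffInd-1 v (χ (cls (base M) i)) i (λ t → total-mass (matroid-graph M) (proj₁ (v∈ t)))
    (λ t → CoverFace.class-mass N M mpN mpM {j} {i} cov' (proj₂ (v∈ t)) (proj₁ (v∈ t)))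
    (subst (λ z → z * 2ℚ ≢ 1ℚ) (sym (χ-true (cls (base M) i) (cong not (irrefl M i)))) 2≢1)
  where
  2≢1 : 1ℚ * 2ℚ ≢ 1ℚ
  2≢1 ()
  cov' : Cover N j M i
  cov' = Cover-sym {M = M} {N} {i} {j} (opposite⇒cover {M = M} {N} {i} {j} opp)
  ι = punchIn i
  ij : base M i j ≡ true
  ij = trans (sym (Bool.not-involutive _)) (cong not (trans (sym (opp j)) (irrefl N j)))
  ji : base N j i ≡ true
  ji = trans (opp i) (cong not (irrefl M i))
  g : Fin (suc (suc m)) → Fin (suc (suc m))
  g t = if base M i t then i else j
  g∈ : ∀ t → g t ≡ i ⊎ g t ≡ j
  g∈ t with base M i t
  ... | true  = inj₁ refl
  ... | false = inj₂ refl
  M-edge : ∀ t → base M t (g t) ≡ true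
  M-edge t with base M i t in it
  ... | true  = ∼-sym mpM it
  ... | false = ≁-∼ mpM (≁-sym mpM it) ij
  N-edge : ∀ t → base N t (g t) ≡ true
  N-edge t with base M i t | opp t
  ... | true  | jt = ≁-∼ mpN (≁-sym mpN jt) ji
  ... | false | jt = ∼-sym mpN jt

-- Let D be the shared class and A, B the covering ones. If B were D, the complement of A, which
-- meets two classes of `M`, would lie in the single class D; so B is not D, and likewise for A.
-- Then D is disjoint from A and B, which leaves `i` uncovered.
share-cover-⊥ : ∀ {n} {M K : Rank2Matroid n} → Connected (base M) → Connected (base K) →
  ∀ {i j} → (∀ k → base K j k ≡ base M i k) → ∀ {p q} → ¬ Cover M p K q
share-cover-⊥ {M = M} {K} CM CK {i} {j} share {p} {q} cov =
  clash (cov i)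
  where
  mpM = Connected.isMultipartite CM
  mpK = Connected.isMultipartite CK
  inK : ∀ {k} → base M p k ≡ true → base K q k ≡ false
  inK {k} e with cov k
  ... | inj₁ f = ⊥-elim (true≢false e f)
  ... | inj₂ f = f
  inM : ∀ {k} → base K q k ≡ true → base M p k ≡ false
  inM {k} e with cov k
  ... | inj₁ f = f
  ... | inj₂ f = ⊥-elim (true≢false e f)
  jq : base K j q ≡ true
  jq with Connected.others CM p | base K j q in e
  ... | _ | true = refl
  ... | u , v , pu , pv , uv | false = ⊥-elim (true≢false uv
        (≁-trans mpM (≁-sym mpM (inD (inK pu))) (inD (inK pv))))
    where
    inD : ∀ {k} → base K q k ≡ false → base M i k ≡ false
    inD {k} f = trans (sym (share k)) (≁-trans mpK e f)
  ip : base M i p ≡ true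
  ip with Connected.others CK q | base M i p in e
  ... | _ | true = refl
  ... | u , v , qu , qv , uv | false = ⊥-elim (true≢false uv
        (≁-trans mpK (≁-sym mpK (inD (inM qu))) (inD (inM qv))))
    where
    inD : ∀ {k} → base M p k ≡ false → base K j k ≡ false
    inD {k} f = trans (share k) (≁-trans mpM e f)
  clash : base M p i ≡ false ⊎ base K q i ≡ false → ⊥
  clash (inj₁ pi) = true≢false (∼-sym mpM ip) pi
  clash (inj₂ qi) = true≢false jq (≁-trans mpK (trans (share i) (irrefl M i)) (≁-sym mpK qi))

-- The cell x(D) = 1, x_z = 0 of codimension 2, where D is a common class of M and K and z ∉ D.
module CommonCell {m} (M K : Rank2Matroid (suc (suc (suc m)))) (mpM : Multipartite (base M)) (mpK : Multipartite (base K))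
  {i j} (share : ∀ k → base K j k ≡ base M i k)
  {u z} (iu : base M i u ≡ true) (iz : base M i z ≡ true) (uz : base M u z ≡ true) where

  private
    n : ℕ
    n = suc (suc (suc m))

  -- As x(D) ≤ 1 and x_z ≥ 0, the value 1 forces both equalities at once, so a single functional
  -- exposes the cell.
  c : Pt n
  c k = χ (cls (base M) i) k - δ z k

  cell : PSet n
  cell x = BP M x × c · x ≡ 1ℚ

  -- The value of `c` at an element: `d` says that it lies outside D, `e` that it is `z`.
  ⟦_,_⟧ : Bool → Bool → ℚ
  ⟦ d , e ⟧ = (if not d then 1ℚ else 0ℚ) - (if e then 1ℚ else 0ℚ)

  bool-valid : ∀ d d' e e' → d ≡ true ⊎ d' ≡ true → ⟦ d , e ⟧ + ⟦ d' , e' ⟧ ≤ 1ℚ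
  bool-valid true  true  true  true  _ = from-yes (⟦ true , true ⟧ + ⟦ true , true ⟧ ℚ.≤? 1ℚ)
  bool-valid true  true  true  false _ = from-yes (⟦ true , true ⟧ + ⟦ true , false ⟧ ℚ.≤? 1ℚ)
  bool-valid true  true  false true  _ = from-yes (⟦ true , false ⟧ + ⟦ true , true ⟧ ℚ.≤? 1ℚ)
  bool-valid true  true  false false _ = from-yes (⟦ true , false ⟧ + ⟦ true , false ⟧ ℚ.≤? 1ℚ)
  bool-valid true  false true  true  _ = from-yes (⟦ true , true ⟧ + ⟦ false , true ⟧ ℚ.≤? 1ℚ)
  bool-valid true  false true  false _ = from-yes (⟦ true , true ⟧ + ⟦ false , false ⟧ ℚ.≤? 1ℚ)
  bool-valid true  false false true  _ = from-yes (⟦ true , false ⟧ + ⟦ false , true ⟧ ℚ.≤? 1ℚ)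
  bool-valid true  false false false _ = from-yes (⟦ true , false ⟧ + ⟦ false , false ⟧ ℚ.≤? 1ℚ)
  bool-valid false true  true  true  _ = from-yes (⟦ false , true ⟧ + ⟦ true , true ⟧ ℚ.≤? 1ℚ)
  bool-valid false true  true  false _ = from-yes (⟦ false , true ⟧ + ⟦ true , false ⟧ ℚ.≤? 1ℚ)
  bool-valid false true  false true  _ = from-yes (⟦ false , false ⟧ + ⟦ true , true ⟧ ℚ.≤? 1ℚ)
  bool-valid false true  false false _ = from-yes (⟦ false , false ⟧ + ⟦ true , false ⟧ ℚ.≤? 1ℚ)
  bool-valid false false _ _ (inj₁ ())
  bool-valid false false _ _ (inj₂ ())

  cellEdge : Bool → Bool → Bool → Bool → Bool
  cellEdge d d' e e' = (d xor d') ∧ (not e ∧ not e')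

  bool-tight : ∀ d d' e e' → d ≡ true ⊎ d' ≡ true → ⟦ d , e ⟧ + ⟦ d' , e' ⟧ ≡ 1ℚ → cellEdge d d' e e' ≡ true
  bool-tight true  false false false _ _ = refl
  bool-tight false true  false false _ _ = refl
  bool-tight false false _ _ (inj₁ ())
  bool-tight false false _ _ (inj₂ ())
  bool-tight true  true  true  true  _ ()
  bool-tight true  true  true  false _ ()
  bool-tight true  true  false true  _ ()
  bool-tight true  true  false false _ ()
  bool-tight true  false true  true  _ ()
  bool-tight true  false true  false _ ()
  bool-tight true  false false true  _ ()
  bool-tight false true  true  true  _ ()
  bool-tight false true  true  false _ ()
  bool-tight false true  false true  _ ()

  -- Pairs that cross D and avoid `z`. Only D and `z` enter, which is why the same cell is a face of
  -- both polytopes.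
  E : Fin n → Fin n → Bool
  E a b = cellEdge (base M i a) (base M i b) ⌊ a ≟ z ⌋ ⌊ b ≟ z ⌋

  module InClass (L : Rank2Matroid n) (mpL : Multipartite (base L)) {ℓ} (shareL : ∀ k → base L ℓ k ≡ base M i k) where

    escape : ∀ a b → base L a b ≡ true → base M i a ≡ true ⊎ base M i b ≡ true
    escape a b ab with base M i a in ia | base M i b in ib
    ... | true  | _     = inj₁ refl
    ... | false | true  = inj₂ refl
    ... | false | false = ⊥-elim (true≢false ab (≁-trans mpL (≁-sym mpL (trans (shareL a) ia)) (trans (shareL b) ib)))

    valid : ∀ a b → base L a b ≡ true → c a + c b ≤ 1ℚ
    valid a b ab = bool-valid (base M i a) (base M i b) ⌊ a ≟ z ⌋ ⌊ b ≟ z ⌋ (escape a b ab)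

    bound : ∀ x → BP L x → c · x ≤ 1ℚ
    bound x p = valid-≤ (Conv⇒Weights (matroid-graph L) p) c valid

    to-E : ∀ {x} → BP L x → c · x ≡ 1ℚ → Weights E x
    to-E p t = restrict (Conv⇒Weights (matroid-graph L) p) c valid t
      (λ a b ab e → bool-tight (base M i a) (base M i b) ⌊ a ≟ z ⌋ ⌊ b ≟ z ⌋ (escape a b ab) e)

    E-edge : ∀ a b → E a b ≡ true → base L a b ≡ true
    E-edge a b e with base M i a | base M i b | shareL a | shareL b
    ... | true  | false | ℓa | ℓb = ∼-sym mpL (≁-∼ mpL (≁-sym mpL ℓb) ℓa)
    ... | false | true  | ℓa | ℓb = ≁-∼ mpL (≁-sym mpL ℓa) ℓb
    E-edge a b () | true  | true  | _ | _
    E-edge a b () | false | false | _ | _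

    from-E : ∀ {x} → Weights E x → BP L x
    from-E (weights w nn sm sp deg tot) = Weights⇒Conv (matroid-graph L)
      (weights w nn sm (λ a b e → sp a b (non-edge a b e)) deg tot)
      where
      non-edge : ∀ a b → base L a b ≡ false → E a b ≡ false
      non-edge a b f with E a b in e
      ... | false = refl
      ... | true  = ⊥-elim (true≢false (E-edge a b e) f)

  module InM = InClass M mpM {i} (λ _ → refl)
  module InK = InClass K mpK {j} share

  cell-face-M : IsFace cell (BP M)
  cell-face-M = c , 1ℚ , InM.bound , λ x → id , id

  cell-face-K : IsFace cell (BP K)
  cell-face-K = c , 1ℚ , InK.bound , λ x →
    (λ { (p , t) → InK.from-E (InM.to-E p t) , t }) ,
    (λ { (p , t) → InM.from-E (InK.to-E p t) , t })

  i≢z : i ≢ z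
  i≢z = edge-≢ (matroid-graph M) iz

  u≢z : u ≢ z
  u≢z = edge-≢ (matroid-graph M) uz

  ι : Fin (suc m) → Fin n
  ι t = punchIn i (punchIn (punchOut i≢z) t)

  ι-injective : ∀ {s t} → ι s ≡ ι t → s ≡ t
  ι-injective e = punchIn-injective (punchOut i≢z) _ _ (punchIn-injective i _ _ e)

  ι≢z : ∀ t → ι t ≢ z
  ι≢z t e = punchInᵢ≢i (punchOut i≢z) t (punchIn-injective i _ _ (trans e (sym (punchIn-punchOut i≢z))))

  g : Fin n → Fin n
  g t = if base M i t then i else u

  g∈ : ∀ t → g t ≡ i ⊎ g t ≡ u
  g∈ t with base M i t
  ... | true  = inj₁ refl
  ... | false = inj₂ refl

  g-edge : ∀ t → base M t (g t) ≡ true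
  g-edge t with base M i t in it
  ... | true  = ∼-sym mpM it
  ... | false = ≁-∼ mpM (≁-sym mpM it) iu

  c-off : ∀ {k d} → k ≢ z → base M i k ≡ d → c k ≡ ⟦ d , false ⟧
  c-off {k} k≢z refl = cong (λ d → χ (cls (base M) i) k - d) (δ-≢ k≢z)

  g-tight : ∀ t → t ≢ z → c t + c (g t) ≡ 1ℚ
  g-tight t t≢z = by-side (base M i t) refl
    where
    by-side : ∀ d → base M i t ≡ d → c t + c (if d then i else u) ≡ 1ℚ
    by-side true  it = cong₂ _+_ {c t} {⟦ true , false ⟧} {c i} {⟦ false , false ⟧}
                         (c-off t≢z it) (c-off i≢z (irrefl M i))
    by-side false it = cong₂ _+_ {c t} {⟦ false , false ⟧} {c u} {⟦ true , false ⟧}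
                         (c-off t≢z it) (c-off u≢z iu)

  -- On the cell the complement of D has mass 1 with or without `z`: the equations x(D) = 1 and x_z
  -- = 0 in the form that `¬AffInd-2` takes.
  X Y : Fin n → Bool
  X k = base M i k ∧ not ⌊ k ≟ z ⌋
  Y = base M i

  X-bool : ∀ d d' e e' → cellEdge d d' e e' ≡ true →
    (if d ∧ not e then 1ℚ else 0ℚ) + (if d' ∧ not e' then 1ℚ else 0ℚ) ≡ 1ℚ
  X-bool true  false false false _ = refl
  X-bool false true  false false _ = refl

  Y-bool : ∀ d d' e e' → cellEdge d d' e e' ≡ true → (if d then 1ℚ else 0ℚ) + (if d' then 1ℚ else 0ℚ) ≡ 1ℚ
  Y-bool true  false _ _ _ = refl
  Y-bool false true  _ _ _ = refl

  X-mass : ∀ {x} → cell x → χ X · x ≡ 1ℚ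
  X-mass (p , t) = valid-≡ (InM.to-E p t) (χ X) (λ a b → X-bool (base M i a) (base M i b) ⌊ a ≟ z ⌋ ⌊ b ≟ z ⌋)

  Y-mass : ∀ {x} → cell x → χ Y · x ≡ 1ℚ
  Y-mass (p , t) = valid-≡ (InM.to-E p t) (χ Y) (λ a b → Y-bool (base M i a) (base M i b) ⌊ a ≟ z ⌋ ⌊ b ≟ z ⌋)

  Xu : X u ≡ true
  Xu rewrite iu with u ≟ z
  ... | yes e = ⊥-elim (u≢z e)
  ... | no _  = refl

  Xz : X z ≡ false
  Xz rewrite iz with z ≟ z
  ... | yes _ = refl
  ... | no ne = ⊥-elim (ne refl)

  cell-dim : HasDim cell m
  cell-dim =
    ((λ t → ind (ι t) (g (ι t))) ,
     (λ t → vertex∈Conv (base M) (g-edge (ι t)) ,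
            trans (ind-dot c (edge-≢ (matroid-graph M) (g-edge (ι t)))) (g-tight (ι t) (ι≢z t))) ,
     doubleStar-AffInd ι ι-injective i u (λ t → punchInᵢ≢i i _) g g∈) ,
    λ v v∈ → ¬AffInd-2 v X Y {u} {z} Xu Xz iu iz
      (λ t → total-mass (matroid-graph M) (proj₁ (v∈ t))) (λ t → X-mass (v∈ t)) (λ t → Y-mass (v∈ t))

-- Splitting a class into points

-- The class `r` stays whole and all other elements become singletons. In a completion `r` is
-- `base M i`, the complement of the class of `i`; with `r` empty this is the uniform matroid.
splitEdge : ∀ {n} → (Fin n → Bool) → Fin n → Fin n → Bool
splitEdge r a b = not ⌊ a ≟ b ⌋ ∧ not (r a ∧ r b)

splitEdge-intro : ∀ {n} (r : Fin n → Bool) {a b} → a ≢ b → r a ≡ false ⊎ r b ≡ false → splitEdge r a b ≡ true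
splitEdge-intro r {a} {b} a≢b h with a ≟ b
... | yes e = ⊥-elim (a≢b e)
... | no _ with r a | r b | h
...   | false | _     | _ = refl
...   | true  | false | _ = refl
...   | true  | true  | inj₁ ()
...   | true  | true  | inj₂ ()

splitEdge-elim : ∀ {n} (r : Fin n → Bool) {a b} → splitEdge r a b ≡ true → a ≢ b × (r a ≡ false ⊎ r b ≡ false)
splitEdge-elim r {a} {b} e with a ≟ b
splitEdge-elim r () | yes _
... | no a≢b with r a | r b
...   | false | _     = a≢b , inj₁ refl
...   | true  | false = a≢b , inj₂ refl

splitEdge-multipartite : ∀ {n} (r : Fin n → Bool) → Multipartite (splitEdge r)
splitEdge-multipartite r = multipartite (graph irr sm) cotr
  where
  irr : ∀ a → splitEdge r a a ≡ false
  irr a with a ≟ a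
  ... | yes _ = refl
  ... | no ne = ⊥-elim (ne refl)
  sm : ∀ a b → splitEdge r a b ≡ splitEdge r b a
  sm a b rewrite Bool.∧-comm (r a) (r b) with a ≟ b | b ≟ a
  ... | yes _ | yes _ = refl
  ... | no _  | no _  = refl
  ... | yes e | no ne = ⊥-elim (ne (sym e))
  ... | no ne | yes e = ⊥-elim (ne (sym e))
  cotr : ∀ {a} b {c} → splitEdge r a c ≡ true → splitEdge r a b ≡ true ⊎ splitEdge r b c ≡ true
  cotr {a} b {c} e with splitEdge-elim r {a} {c} e
  ... | _ , h = by-cases (a ≟ b) (b ≟ c) h
    where
    by-cases : Dec (a ≡ b) → Dec (b ≡ c) → r a ≡ false ⊎ r c ≡ false → splitEdge r a b ≡ true ⊎ splitEdge r b c ≡ true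
    by-cases (yes refl) _          _         = inj₂ e
    by-cases (no _)     (yes refl) _         = inj₁ e
    by-cases (no a≢b)   (no _)     (inj₁ ra) = inj₁ (splitEdge-intro r a≢b (inj₁ ra))
    by-cases (no _)     (no b≢c)   (inj₂ rc) = inj₂ (splitEdge-intro r b≢c (inj₂ rc))

fromMultipartite : ∀ {n} {B : Fin n → Fin n → Bool} → Multipartite B → (∃₂ λ i j → B i j ≡ true) → Rank2Matroid n
fromMultipartite {B = B} mp ne = record
  { base = B ; irrefl = B-irrefl ; symm = B-sym ; nonempty = ne ; exchange = ex }
  where
  open Multipartite mp
  ex : ∀ a b c d → B a b ≡ true → B c d ≡ true → a ≢ c → a ≢ d →
    ∃ λ y → (y ≡ c ⊎ y ≡ d) × y ≢ a × y ≢ b × B b y ≡ true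
  ex a b c d _ cd a≢c a≢d with cotrans b cd
  ... | inj₁ cb = c , inj₁ refl , a≢c ∘ sym , edge-≢ isGraph cb , ∼-sym mp cb
  ... | inj₂ bd = d , inj₂ refl , a≢d ∘ sym , edge-≢ isGraph bd ∘ sym , bd

splitMatroid : ∀ {n} (r : Fin n → Bool) {i j u} → i ≢ j → i ≢ u → j ≢ u → r i ≡ false → r j ≡ false →
  Σ (Rank2Matroid n) λ E → (∀ a b → base E a b ≡ splitEdge r a b) × Connected (base E)
splitMatroid r {i} {j} {u} i≢j i≢u j≢u ri rj =
  fromMultipartite mp (i , j , splitEdge-intro r i≢j (inj₁ ri)) , (λ _ _ → refl) ,
  connected mp (i , j , u , splitEdge-intro r i≢j (inj₁ ri) , splitEdge-intro r j≢u (inj₁ rj) , splitEdge-intro r i≢u (inj₁ ri))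
  where mp = splitEdge-multipartite r

splitEdge-outside : ∀ {n} (r : Fin n → Bool) {u} → r u ≡ true → ∀ k → splitEdge r u k ≡ not (r k)
splitEdge-outside r {u} ru k rewrite ru with u ≟ k
... | yes refl rewrite ru = refl
... | no _ = refl

collect : ∀ {X Y : Set} {P : X → Y → Set} {R : X → Set} (xs : List X) → (∀ x → x ∈ xs → ∃ (P x) ⊎ R x) →
  Σ (List Y) λ ys → (∀ y → y ∈ ys → ∃ λ x → x ∈ xs × P x y) × (∀ x → x ∈ xs → R x ⊎ ∃ λ y → y ∈ ys × P x y)
collect [] h = [] , (λ _ ()) , (λ _ ())
collect {P = P} {R} (x ∷ xs) h with collect {P = P} {R} xs (λ y m → h y (there m)) | h x (here refl)
... | ys , back , forth | inj₂ r =
  ys , (λ y m → let x' , m' , p = back y m in x' , there m' , p) ,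
  λ { _ (here refl) → inj₁ r ; x' (there m) → forth x' m }
... | ys , back , forth | inj₁ (y₀ , p₀) =
  y₀ ∷ ys ,
  (λ { _ (here refl) → x , here refl , p₀ ; y (there m) → let x' , m' , p = back y m in x' , there m' , p }) ,
  λ { _ (here refl) → inj₂ (y₀ , here refl , p₀)
    ; x' (there m) → Sum.map₂ (λ { (y , m' , p) → y , there m' , p }) (forth x' m) }

size : ∀ {n} → (Fin n → Bool) → ℕ
size A = ∣ tabulate A ∣

size-< : ∀ {n} (A B : Fin n → Bool) → (∀ k → A k ≡ true → B k ≡ true) → ∀ {w} → A w ≡ false → B w ≡ true → size A ℕ.< size B
size-< A B A⊆B {w} Aw Bw = p⊂q⇒∣p∣<∣q∣
  ((λ {k} m → to B (A⊆B k (from A m))) , w , to B Bw , λ m → true≢false (from A m) Aw)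
  where
  to : ∀ C {k} → C k ≡ true → k ∈ˢ tabulate C
  to C {k} e = lookup⇒[]= k (tabulate C) (trans (lookup∘tabulate C k) e)
  from : ∀ C {k} → k ∈ˢ tabulate C → C k ≡ true
  from C {k} m = trans (sym (lookup∘tabulate C k)) ([]=⇒lookup m)

χ-cong : ∀ {n} {A B : Fin n → Bool} → (∀ k → A k ≡ B k) → ∀ x → χ A · x ≡ χ B · x
χ-cong e x = sumF-cong (λ k → cong (λ b → (if b then 1ℚ else 0ℚ) * x k) (e k))

point-mass : ∀ {n} {x : Pt n} → Weights (λ a b → not ⌊ a ≟ b ⌋) x → (A : Fin n → Bool) →
  (∀ a b → A a ≡ true → A b ≡ true → a ≡ b) → χ A · x ≤ 1ℚ
point-mass W A sub = valid-≤ W (χ A) valid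
  where
  valid : ∀ a b → not ⌊ a ≟ b ⌋ ≡ true → χ A a + χ A b ≤ 1ℚ
  valid a b e with a ≟ b
  valid a b () | yes _
  valid a b e  | no a≢b with A a in ea | A b in eb
  ... | true  | true  = ⊥-elim (a≢b (sub a b ea eb))
  ... | true  | false = ℚ.≤-refl
  ... | false | true  = ℚ.≤-refl
  ... | false | false = from-yes (0ℚ ℚ.≤? 1ℚ)

compl-mass : ∀ {n} {B : Fin n → Fin n → Bool} {x : Pt n} → Weights B x → (A : Fin n → Bool) →
  ¬ (χ A · x ≤ 1ℚ) → χ (not ∘ A) · x ≤ 1ℚ
compl-mass {x = x} W A h with χ (not ∘ A) · x ℚ.≤? 1ℚ
... | yes p = p
... | no np = ⊥-elim (ℚ.<-irrefl (sym (χ-dot-compl A (Weights.total W))) (ℚ.+-mono-< (ℚ.≰⇒> h) (ℚ.≰⇒> np)))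

Opposite : ∀ {n} → Rank2Matroid n → Fin n → Rank2Matroid n → Fin n → Set
Opposite M i N j = ∀ k → base N j k ≡ not (base M i k)

Opposite-sym : ∀ {n} {M N : Rank2Matroid n} {i j} → Opposite M i N j → Opposite N j M i
Opposite-sym {M = M} {i = i} opp k = trans (sym (Bool.not-involutive (base M i k))) (cong not (sym (opp k)))

HasNbr : ∀ {n} → Collection n → Rank2Matroid n → Fin n → Set
HasNbr Σ' M i = ∃ λ K → K ∈ Σ' × ∃ λ k → Opposite M i K k

hasNbr? : ∀ {n} (Σ' : Collection n) M i → Dec (HasNbr Σ' M i)
hasNbr? Σ' M i = map′ find (λ { (_ , K∈ , o) → lose K∈ o })
  (Any.any? (λ K → any? (λ k → all? (λ l → base K k l Bool.≟ not (base M i l)))) Σ')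

HasNbr-resp : ∀ {n} {Σ' : Collection n} {M : Rank2Matroid n} {i j} → Multipartite (base M) → base M i j ≡ false →
  HasNbr Σ' M i → HasNbr Σ' M j
HasNbr-resp mp e (K , K∈ , k , opp) = K , K∈ , k , λ l → trans (opp l) (cong not (≁-cong mp e l))

facetAdj : ∀ {m} {Σ' : Collection (suc (suc m))} (M N : Rank2Matroid (suc (suc m))) → M ∈ Σ' → N ∈ Σ' →
  Multipartite (base M) → Multipartite (base N) → ∀ {i j} → Opposite M i N j → FacetAdj Σ' M N
facetAdj M N M∈ N∈ mpM mpN {i} {j} opp =
  let fM , fN = cover⇒faces M N mpM mpN {i} {j} (opposite⇒cover {M = M} {N} {i} {j} opp)
  in M∈ , N∈ , fM , fN , opposite⇒HasDim M N mpM mpN {i} {j} opp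

-- A pair crossing the shared class is a common vertex, so the polytopes are not disjoint; a common
-- face of different members would give covering classes, which a shared class forbids.
share-fitting⇒Same : ∀ {n} (M K : Rank2Matroid n) → Connected (base M) → Connected (base K) →
  ∀ {i j} → (∀ k → base K j k ≡ base M i k) → FaceFitting (BP M) (BP K) → Same M K
share-fitting⇒Same M K CM CK {i} share (inj₁ disj) with Connected.others CM i
... | u , _ , iu , _ = ⊥-elim (disj (ind i u) (vertex∈Conv (base M) iu , vertex∈Conv (base K)
        (≁-∼ mpK (≁-sym mpK (trans (share i) (irrefl M i))) (trans (share u) iu))))
  where mpK = Connected.isMultipartite CK
share-fitting⇒Same M K CM CK {i} {j} share (inj₂ (fM , fK)) with faces⇒cover M K CM CK fM fK
... | inj₁ s = s
... | inj₂ (p , q , cov) = ⊥-elim (share-cover-⊥ {M = M} {K} CM CK {i} {j} share {p} {q} cov)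

cell-fitting : ∀ {m} {Σ' : Collection (suc (suc (suc m)))} → Semitiling (suc (suc (suc m))) Σ' →
  ∀ M K → M ∈ Σ' → K ∈ Σ' → Multipartite (base M) → Multipartite (base K) →
  ∀ {i j} → (∀ k → base K j k ≡ base M i k) →
  ∀ {u z} → base M i u ≡ true → base M i z ≡ true → base M u z ≡ true →
  ¬ (BP M ≐ BP K) → FaceFitting (BP M) (BP K)
cell-fitting (_ , fits) M K M∈ K∈ mpM mpK {i} {j} share {u} {z} iu iz uz =
  fits C.cell (M , M∈ , C.cell-face-M , C.cell-dim) M K M∈ K∈ C.cell-face-M C.cell-face-K
  where module C = CommonCell M K mpM mpK {i} {j} share {u} {z} iu iz uz

-- The tree of a connected semitiling

Adj : ∀ {n} → Collection n → Rank2Matroid n → Rank2Matroid n → Set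
Adj Σ' M N = M ∈ Σ' × N ∈ Σ' × ∃₂ λ i j → Opposite M i N j

-- The codimension-2 condition enters only through `unique`: a set is a class of at most one member,
-- up to `Same`.
module Tree {n} (Σ₀ : Collection n)
  (conn₀ : ∀ {M} → M ∈ Σ₀ → Connected (base M))
  (unique : ∀ {M K} → M ∈ Σ₀ → K ∈ Σ₀ → ∀ {i j} → (∀ k → base K j k ≡ base M i k) → Same M K)
  (linked : ∀ M N → M ∈ Σ₀ → N ∈ Σ₀ → Star (Adj Σ₀) M N) where

  mp₀ : ∀ {M} → M ∈ Σ₀ → Multipartite (base M)
  mp₀ M∈ = Connected.isMultipartite (conn₀ M∈)

  -- A walk without backtracking: it keeps leaving through a class other than the one it entered by,
  -- so the sets behind it grow.
  data Chain (N : Rank2Matroid n) (M : Rank2Matroid n) : Set where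
    here : Same M N → Chain N M
    step : ∀ {i j K k} → K ∈ Σ₀ → Opposite M i K k → Chain N K → Cover M i N j → HasNbr Σ₀ N j → Chain N M

  Chain-resp : ∀ {N M M'} → Same M' M → Chain N M → Chain N M'
  Chain-resp s (here t) = here (λ a b → trans (s a b) (t a b))
  Chain-resp s (step {i} K∈ opp ch cov nb) = step {i = i} K∈ (λ l → trans (opp l) (cong not (sym (s i l)))) ch
    (λ l → Sum.map₁ (trans (s i l)) (cov l)) nb

  -- If the walk leaves `M` through the class by which it was entered from `L`, then `K` has the
  -- class of `c` in common with `L`, so `K` is `L` and the two steps cancel. Otherwise the class of
  -- `c` in `L` contains that of `i` in `M` and inherits the cover.
  prepend : ∀ {N M L c d} → L ∈ Σ₀ → M ∈ Σ₀ → Opposite L c M d → Chain N M → Chain N L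
  prepend {N} {M} {L} {c} {d} L∈ M∈ opp (here s) =
    step {i = c} {d} M∈ opp (here s) cov (L , L∈ , c , λ l → trans (Opposite-sym {M = L} {M} {c} {d} opp l) (cong not (s d l)))
    where
    cov : Cover L c N d
    cov l = Sum.map₂ (trans (sym (s d l))) (opposite⇒cover {M = L} {M} {c} {d} opp l)
  prepend {N} {M} {L} {c} {d} L∈ M∈ opp ch@(step {i} {j} {K} {k} K∈ opp' ch' cov nb) with base M d i in di
  ... | false = Chain-resp {N} {K} {L} (unique L∈ K∈ {c} {k} share) ch'
    where
    share : ∀ l → base K k l ≡ base L c l
    share l = trans (opp' l) (trans (cong not (sym (≁-cong (mp₀ M∈) di l)))
      (sym (Opposite-sym {M = L} {M} {c} {d} opp l)))
  ... | true = step {i = c} {j} M∈ opp ch cov' nb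
    where
    cov' : Cover L c N j
    cov' l with base L c l in cl | cov l
    ... | false | _ = inj₁ refl
    ... | true  | inj₂ e = inj₂ e
    ... | true  | inj₁ il = ⊥-elim (true≢false di
            (≁-trans (mp₀ M∈) (trans (opp l) (cong not cl)) (≁-sym (mp₀ M∈) il)))

  chain : ∀ {M N} → Star (Adj Σ₀) M N → Chain N M
  chain ε = here (λ _ _ → refl)
  chain ((M∈ , L∈ , i , j , opp) ◅ rest) = prepend {c = i} {j} M∈ L∈ opp (chain rest)

  separated : ∀ {M N} → M ∈ Σ₀ → N ∈ Σ₀ →
    Same M N ⊎ ∃₂ λ i j → Cover M i N j × HasNbr Σ₀ M i × HasNbr Σ₀ N j
  separated {M} {N} M∈ N∈ with chain (linked M N M∈ N∈)
  ... | here s = inj₁ s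
  ... | step {i} {j} {K} {k} K∈ opp _ cov nb = inj₂ (i , j , cov , (K , K∈ , k , opp) , nb)

  -- Completing the tree

  record Completes (M : Rank2Matroid n) (i : Fin n) (E : Rank2Matroid n) : Set where
    field
      split : ∀ a b → base E a b ≡ splitEdge (base M i) a b
      conn-E : Connected (base E)
      unmatched : ¬ HasNbr Σ₀ M i
      outer : Fin n
      outer-∼ : base M i outer ≡ true
    mp-E : Multipartite (base E)
    mp-E = Connected.isMultipartite conn-E
    opposite : Opposite M i E outer
    opposite k = trans (split outer k) (splitEdge-outside (base M i) outer-∼ k)

  -- Nothing is to be attached at a singleton class: its inequality x_i ≤ 1 holds on all of Δ(2,n).
  Closed : Rank2Matroid n → Fin n → Set
  Closed M i = HasNbr Σ₀ M i ⊎ (∀ j → base M i j ≡ false → i ≡ j)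

  complete-at : ∀ {M} → M ∈ Σ₀ → ∀ i → ∃ (Completes M i) ⊎ Closed M i
  complete-at {M} M∈ i with hasNbr? Σ₀ M i | any? (λ j → (base M i j Bool.≟ false) ×-dec ¬? (i ≟ j))
  ... | yes nb | _ = inj₂ (inj₁ nb)
  ... | no _   | no none = inj₂ (inj₂ (λ j e → decidable-stable (i ≟ j) (λ ne → none (j , e , ne))))
  ... | no un  | yes (j , ij , i≢j) with Connected.others (conn₀ M∈) i
  ...   | u , _ , iu , _ =
    let E , sp , cE = splitMatroid (base M i) {i} {j} {u} i≢j (λ { refl → true≢false iu (irrefl M i) })
                        (λ { refl → true≢false iu ij }) (irrefl M i) ij
    in inj₁ (E , record { split = sp ; conn-E = cE ; unmatched = un ; outer = u ; outer-∼ = iu })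

  private
    sites = cartesianProduct Σ₀ (allFin n)

    completions = collect {P = λ { (M , i) → Completes M i }} {R = λ { (M , i) → Closed M i }} sites
      (λ { (M , i) m → complete-at (proj₁ (∈-cartesianProduct⁻ Σ₀ (allFin n) m)) i })

  Σₑ : Collection n
  Σₑ = proj₁ completions

  completes : ∀ {E} → E ∈ Σₑ → ∃ λ M → M ∈ Σ₀ × ∃ λ i → Completes M i E
  completes {E} E∈ with proj₁ (proj₂ completions) E E∈
  ... | (M , i) , m , c = M , proj₁ (∈-cartesianProduct⁻ Σ₀ (allFin n) m) , i , c

  closed : ∀ {M} → M ∈ Σ₀ → ∀ i → Closed M i ⊎ ∃ λ E → E ∈ Σₑ × Completes M i E
  closed {M} M∈ i = proj₂ (proj₂ completions) (M , i) (∈-cartesianProduct⁺ M∈ (∈-allFin i))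

  Σ₁ : Collection n
  Σ₁ = Σ₀ ++ Σₑ

  ⊆₁ : ∀ {M} → M ∈ Σ₀ → M ∈ Σ₁
  ⊆₁ = ∈-++⁺ˡ

  conn₁ : ∀ {M} → M ∈ Σ₁ → Connected (base M)
  conn₁ M∈ with ∈-++⁻ Σ₀ M∈
  ... | inj₁ m = conn₀ m
  ... | inj₂ e = let _ , _ , _ , c = completes e in Completes.conn-E c

  -- Let `E` hang on `L` across A. If `M` is `L`, then A and its complement cover. Otherwise the
  -- covering class of `L` has a neighbour and A has none, so it is disjoint from A and lies in the
  -- large class of `E`.
  mixed : ∀ {M E} → M ∈ Σ₀ → E ∈ Σₑ → Same M E ⊎ ∃₂ λ i j → Cover M i E j
  mixed {M} {E} M∈ E∈ with completes E∈
  ... | L , L∈ , i , c with separated M∈ L∈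
  ...   | inj₁ s = inj₂ (i , outer , λ k → Sum.map₁ (trans (s i k)) (opposite⇒cover {M = L} {E} {i} {outer} opposite k))
    where open Completes c
  ...   | inj₂ (p , q , cov , _ , nb) = inj₂ (p , outer , λ k → Sum.map₂ (inside k) (cov k))
    where
    open Completes c
    inside : ∀ k → base L q k ≡ false → base E outer k ≡ false
    inside k qk with base L q i in qi
    ... | false = ⊥-elim (unmatched (HasNbr-resp {M = L} (mp₀ L∈) qi nb))
    ... | true  = trans (opposite k) (cong not (∼-sym (mp₀ L∈) (≁-∼ (mp₀ L∈) (≁-sym (mp₀ L∈) qk) qi)))

  -- For different parents the covering classes are enlarged on both sides as in `mixed`. For a
  -- common parent, one class gives one completion, and two classes are disjoint, so their
  -- complements cover.
  both-new : ∀ {E F} → E ∈ Σₑ → F ∈ Σₑ → Same E F ⊎ ∃₂ λ i j → Cover E i F j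
  both-new {E} {F} E∈ F∈ with completes E∈ | completes F∈
  ... | M , M∈ , i , c | L , L∈ , j , d with separated M∈ L∈
  ...   | inj₂ (p , q , cov , nb , nb') = inj₂ (C.outer , D.outer , λ k → Sum.map (insideM k) (insideL k) (cov k))
    where
    module C = Completes c
    module D = Completes d
    insideM : ∀ k → base M p k ≡ false → base E C.outer k ≡ false
    insideM k pk with base M p i in pi
    ... | false = ⊥-elim (C.unmatched (HasNbr-resp {M = M} (mp₀ M∈) pi nb))
    ... | true  = trans (C.opposite k) (cong not (∼-sym (mp₀ M∈) (≁-∼ (mp₀ M∈) (≁-sym (mp₀ M∈) pk) pi)))
    insideL : ∀ k → base L q k ≡ false → base F D.outer k ≡ false
    insideL k qk with base L q j in qj
    ... | false = ⊥-elim (D.unmatched (HasNbr-resp {M = L} (mp₀ L∈) qj nb'))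
    ... | true  = trans (D.opposite k) (cong not (∼-sym (mp₀ L∈) (≁-∼ (mp₀ L∈) (≁-sym (mp₀ L∈) qk) qj)))
  ...   | inj₁ s with base M i j in ij
  ...     | false = inj₁ (λ a b → trans (C.split a b) (trans
              (cong₂ (λ x y → not ⌊ a ≟ b ⌋ ∧ not (x ∧ y)) (same-class a) (same-class b)) (sym (D.split a b))))
    where
    module C = Completes c
    module D = Completes d
    same-class : ∀ k → base M i k ≡ base L j k
    same-class k = trans (≁-cong (mp₀ M∈) ij k) (s j k)
  ...     | true = inj₂ (C.outer , D.outer , cov)
    where
    module C = Completes c
    module D = Completes d
    cov : Cover E C.outer F D.outer
    cov k with base M i k in ik
    ... | true  = inj₁ (trans (C.opposite k) (cong not ik))
    ... | false = inj₂ (trans (D.opposite k) (cong not (trans (sym (s j k))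
                    (∼-sym (mp₀ M∈) (≁-∼ (mp₀ M∈) (≁-sym (mp₀ M∈) ik) ij)))))

  separated₁ : ∀ {M N} → M ∈ Σ₁ → N ∈ Σ₁ → Same M N ⊎ ∃₂ λ i j → Cover M i N j
  separated₁ {M} {N} M∈ N∈ with ∈-++⁻ Σ₀ M∈ | ∈-++⁻ Σ₀ N∈
  ... | inj₁ m | inj₁ k = Sum.map₂ (λ { (i , j , cov , _) → i , j , cov }) (separated m k)
  ... | inj₁ m | inj₂ k = mixed m k
  ... | inj₂ m | inj₂ k = both-new m k
  ... | inj₂ m | inj₁ k = Sum.map (λ s a b → sym (s a b))
          (λ { (i , j , cov) → j , i , Cover-sym {M = N} {M} {i} {j} cov }) (mixed k m)

  anchor : ∀ {N} → N ∈ Σ₁ → ∃ λ M → M ∈ Σ₀ × Star (Adj Σ₁) N M × Star (Adj Σ₁) M N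
  anchor {N} N∈ with ∈-++⁻ Σ₀ N∈
  ... | inj₁ m = N , m , ε , ε
  ... | inj₂ e with completes e
  ...   | M , M∈ , i , c = M , M∈ ,
      (N∈ , ⊆₁ M∈ , outer , i , Opposite-sym {M = M} {N} {i} {outer} opposite) ◅ ε ,
      (⊆₁ M∈ , N∈ , i , outer , opposite) ◅ ε
    where open Completes c

  linked₁ : ∀ M N → M ∈ Σ₁ → N ∈ Σ₁ → Star (Adj Σ₁) M N
  linked₁ M N M∈ N∈ with anchor M∈ | anchor N∈
  ... | K , K∈ , M→K , _ | L , L∈ , _ , L→N =
    M→K ◅◅ Star.map (λ { (m , k , r) → ⊆₁ m , ⊆₁ k , r }) (linked K L K∈ L∈) ◅◅ L→N

  -- Walking towards a point of Δ(2,n)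

  module _ {x : Pt n} (W : Weights (λ a b → not ⌊ a ≟ b ⌋) x) where

    Heavy : Rank2Matroid n → Fin n → Set
    Heavy M i = ¬ (χ (cls (base M) i) · x ≤ 1ℚ)

    -- The total mass is 2, so the complement of a heavy class has mass below 1; the remaining
    -- classes of `E` are points.
    completion-contains : ∀ {M i E} → Completes M i E → Heavy M i → BP E x
    completion-contains {M} {i} {E} c heavy =
      Weights⇒Conv (matroid-graph E) (class-bounds⇒Weights mp-E W bound)
      where
      open Completes c
      bound : ∀ a → χ (cls (base E) a) · x ≤ 1ℚ
      bound a with base M i a in ia
      ... | true  = subst (_≤ 1ℚ) (χ-cong (λ k → cong not (sym (trans (split a k) (splitEdge-outside (base M i) ia k)))) x)
                      (compl-mass W (cls (base M) i) heavy)
      ... | false = point-mass W (cls (base E) a) (λ k l ak al → trans (sym (only k ak)) (only l al))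
        where
        only : ∀ k → cls (base E) a k ≡ true → a ≡ k
        only k e = decidable-stable (a ≟ k) (λ a≢k → true≢false e
          (cong not (trans (split a k) (splitEdge-intro (base M i) a≢k (inj₁ ia)))))

    -- The class of `K` opposite to the heavy class A is not heavy, so a heavy class of `K` lies
    -- inside A. It is smaller than A because A contains yet another class of `K`.
    heavy-shrinks : ∀ {M i K k} → K ∈ Σ₀ → Opposite M i K k → Heavy M i → ∀ l → Heavy K l →
      size (cls (base K) l) ℕ.< size (cls (base M) i)
    heavy-shrinks {M} {i} {K} {k} K∈ opp heavy l heavy' with base K k l in kl
    ... | false = ⊥-elim (heavy' (subst (_≤ 1ℚ) (χ-cong (λ a → trans (cong not (sym (opp a))) (cong not (≁-cong (mp₀ K∈) kl a))) x)
                    (compl-mass W (cls (base M) i) heavy)))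
    ... | true with third (Connected.others (conn₀ K∈) k)
      where
      third : (∃₂ λ u v → base K k u ≡ true × base K k v ≡ true × base K u v ≡ true) →
        ∃ λ w → base K k w ≡ true × base K l w ≡ true
      third (u , v , ku , kv , uv) with base K l u in lu
      ... | true  = u , ku , lu
      ... | false = v , kv , ≁-∼ (mp₀ K∈) lu uv
    ...   | w , kw , lw = size-< (cls (base K) l) (cls (base M) i)
              (λ a la → trans (sym (opp a)) (∼-sym (mp₀ K∈) (≁-∼ (mp₀ K∈) (≁-sym (mp₀ K∈) (Bool.not-injective la)) (∼-sym (mp₀ K∈) kl))))
              (cong not lw) (trans (sym (opp w)) kw)

    walk : ∀ fuel {M} → M ∈ Σ₀ → (∀ i → Heavy M i → size (cls (base M) i) ℕ.< fuel) →
      ∃ λ N → N ∈ Σ₁ × BP N x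
    walk fuel {M} M∈ small with any? (λ i → ¬? (χ (cls (base M) i) · x ℚ.≤? 1ℚ))
    ... | no none = M , ⊆₁ M∈ , Weights⇒Conv (matroid-graph M) (class-bounds⇒Weights (mp₀ M∈) W
            (λ i → decidable-stable (χ (cls (base M) i) · x ℚ.≤? 1ℚ) (λ h → none (i , h))))
    ... | yes (i , heavy) with closed M∈ i
    ...   | inj₂ (E , E∈ , c) = E , ∈-++⁺ʳ Σ₀ E∈ , completion-contains c heavy
    ...   | inj₁ (inj₂ trivial) = ⊥-elim (heavy (point-mass W (cls (base M) i)
              (λ a b ia ib → trans (sym (trivial a (Bool.not-injective ia))) (trivial b (Bool.not-injective ib)))))
    walk zero M∈ small | yes (i , heavy) | inj₁ (inj₁ _) = ⊥-elim (ℕ.n≮0 (small i heavy))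
    walk (suc fuel) {M} M∈ small | yes (i , heavy) | inj₁ (inj₁ (K , K∈ , k , opp)) =
      walk fuel K∈ (λ l h → ℕ.<-≤-trans (heavy-shrinks {M} {i} {K} {k} K∈ opp heavy l h) (ℕ.≤-pred (small i heavy)))

-- Assembling the theorem

complete-graph : ∀ {n} → Graph {n} (λ a b → not ⌊ a ≟ b ⌋)
complete-graph {n} = graph irr sm
  where
  irr : ∀ (a : Fin n) → not ⌊ a ≟ a ⌋ ≡ false
  irr a with a ≟ a
  ... | yes _ = refl
  ... | no ne = ⊥-elim (ne refl)
  sm : ∀ (a b : Fin n) → not ⌊ a ≟ b ⌋ ≡ not ⌊ b ≟ a ⌋
  sm a b with a ≟ b | b ≟ a
  ... | yes _ | yes _ = refl
  ... | no _  | no _  = refl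
  ... | yes e | no ne = ⊥-elim (ne (sym e))
  ... | no ne | yes e = ⊥-elim (ne (sym e))

BP⊆Δ2 : ∀ {n} (M : Rank2Matroid n) x → BP M x → Δ2 n x
BP⊆Δ2 {n} M x (lam , nn , sp , rest) = lam , nn , (λ a b e → sp a b (non-edge a b e)) , rest
  where
  non-edge : ∀ a b → not ⌊ a ≟ b ⌋ ≡ false → base M a b ≡ false
  non-edge a b e with a ≟ b
  non-edge a b e  | yes refl = irrefl M a
  non-edge a b () | no _

separated⇒fitting : ∀ {n} (M N : Rank2Matroid n) → Multipartite (base M) → Multipartite (base N) →
  Same M N ⊎ (∃₂ λ i j → Cover M i N j) → ¬ (BP M ≐ BP N) → FaceFitting (BP M) (BP N)
separated⇒fitting M N mpM mpN (inj₁ s) ne = ⊥-elim (ne (Same⇒≐ M N s))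
separated⇒fitting M N mpM mpN (inj₂ (i , j , cov)) ne = inj₂ (cover⇒faces M N mpM mpN {i} {j} cov)

module _ {m} {Σ₀ : Collection (suc (suc (suc m)))} (semi : Semitiling (suc (suc (suc m))) Σ₀) where

  member-connected : ∀ {M} → M ∈ Σ₀ → Connected (base M)
  member-connected {M} M∈ = HasDim⇒connected M (proj₁ semi M M∈)

  facetAdj⇒Adj : ∀ {M N} → FacetAdj Σ₀ M N → Adj Σ₀ M N
  facetAdj⇒Adj {M} {N} (M∈ , N∈ , fM , fN , dim) =
    M∈ , N∈ , facet⇒opposite M N (member-connected M∈) (member-connected N∈) fM fN dim

  -- `others` provides two non-parallel elements outside the shared class, hence a common cell of
  -- codimension 2, where the semitiling condition makes the two polytopes face-fitting.
  member-unique : ∀ {M K} → M ∈ Σ₀ → K ∈ Σ₀ → ∀ {i j} → (∀ k → base K j k ≡ base M i k) → Same M K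
  member-unique {M} {K} M∈ K∈ {i} {j} share = Sum.[ id , apart ]′ (same? M K)
    where
    CM = member-connected M∈
    CK = member-connected K∈
    mpM = Connected.isMultipartite CM
    mpK = Connected.isMultipartite CK
    apart : (∃₂ λ a b → base M a b ≢ base K a b) → Same M K
    apart (a , b , ne) = let u , z , iu , iz , uz = Connected.others CM i in
      share-fitting⇒Same M K CM CK share
        (cell-fitting semi M K M∈ K∈ mpM mpK share iu iz uz (λ e → ne (≐⇒Same {M = M} {K} mpM mpK e a b)))

theorem5p1 : (n : ℕ) → 3 ℕ.≤ n → (Σ₀ : Collection n) →
    Semitiling n Σ₀ → ConnectedCodim1 Σ₀ →
    Σ (Collection n) λ Σ₁ →
    Tiling n Σ₁ × ConnectedCodim1 Σ₁ × (Σ₀ ⊑ Σ₁) × Covers Σ₁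
theorem5p1 (suc (suc (suc m))) (s≤s (s≤s (s≤s z≤n))) [] semi conn =
  -- With no member to start from, the uniform matroid is taken, whose polytope is Δ(2,n) itself.
  U ∷ [] ,
  ((λ { _ (here refl) → connected⇒HasDim cU }) ,
   (λ { _ _ (here refl) (here refl) ne → ⊥-elim (ne (λ x → id , id)) })) ,
  (λ { _ _ (here refl) (here refl) → ε }) ,
  (λ _ ()) ,
  λ x → (λ { (lam , nn , sp , rest) → U , here refl , lam , nn , (λ a b e → sp a b (non-edge a b e)) , rest }) ,
        (λ { (M , _ , p) → BP⊆Δ2 M x p })
  where
  uniform = splitMatroid {suc (suc (suc m))} (λ _ → false) {zero} {suc zero} {suc (suc zero)} (λ ()) (λ ()) (λ ()) refl refl
  U = proj₁ uniform
  cU = proj₂ (proj₂ uniform)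
  non-edge : ∀ a b → base U a b ≡ false → not ⌊ a ≟ b ⌋ ≡ false
  non-edge a b e = trans (sym (Bool.∧-identityʳ _)) e
theorem5p1 (suc (suc (suc m))) (s≤s (s≤s (s≤s z≤n))) Σ₀@(M₀ ∷ _) semi conn =
  Σ₁ ,
  ((λ M M∈ → connected⇒HasDim (conn₁ M∈)) , (λ M N M∈ N∈ → separated⇒fitting M N (mp₁ M∈) (mp₁ N∈) (separated₁ M∈ N∈))) ,
  (λ M N M∈ N∈ → Star.map (λ {M} {N} → facet {M} {N}) (linked₁ M N M∈ N∈)) ,
  (λ M M∈ → M , ⊆₁ M∈ , λ x → id , id) ,
  -- The fuel is `n + 1`, more than the size of any class.
  λ x → (λ p → walk (Conv⇒Weights complete-graph p) (suc (suc (suc (suc m)))) (here refl) (λ i _ → s≤s (∣p∣≤n (tabulate (cls (base M₀) i))))) ,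
        (λ { (M , _ , p) → BP⊆Δ2 M x p })
  where
  open Tree Σ₀ (member-connected semi) (member-unique semi)
    (λ M N M∈ N∈ → Star.map (facetAdj⇒Adj semi) (conn M N M∈ N∈))
  mp₁ : ∀ {M} → M ∈ Σ₁ → Multipartite (base M)
  mp₁ M∈ = Connected.isMultipartite (conn₁ M∈)
  facet : ∀ {M N} → Adj Σ₁ M N → FacetAdj Σ₁ M N
  facet {M} {N} (M∈ , N∈ , i , j , opp) = facetAdj M N M∈ N∈ (mp₁ M∈) (mp₁ N∈) {i} {j} opp
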